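{- Let $k\geq 4$ and $2\leq d\leq k-2$. Let $X_{k,d}^3$ consist of the two patterns $321$ and $(d+1,d+2,\dots,k-1,1,k,2,3,\dots,d)$, and let $x_{k,d}^3(n)$ be the number of permutations in $S_n$ avoiding both patterns. Then for all $n\geq k$, $$\sum_{j=0}^{k}(-1)^j\binom{k-j}{j}x_{k,d}^3(n-j)=0,$$ $x_{k,d}^3(n)=\frac{1}{n+1}\binom{2n}{n}$ for all $0\leq n\leq k-1$, and $$\sum_{n\geq0}x_{k,d}^3(n)x^n=\dfrac{U_{k-1}\left(\frac{1}{2\sqrt{x}}\right)}{\sqrt{x}\,U_k\left(\frac{1}{2\sqrt{x}}\right)}.$$
   Context: A permutation $\alpha\in S_n$ contains a pattern $\tau\in S_m$ if there are indices $i_1<\dots<i_m$ with $(\alpha_{i_1},\dots,\alpha_{i_m})$ order-isomorphic to $\tau$; otherwise it avoids $\tau$. $U_m$ is the Chebyshev polynomial of the second kind, $U_m(\cos\theta)=\sin((m+1)\theta)/\sin\theta$. -}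

module Defs where

open import Data.Bool using (Bool; true; false; _∧_; not; if_then_else_)
open import Data.Nat as ℕ using (ℕ; zero; suc; _+_; _∸_; _≡ᵇ_; _<ᵇ_)
open import Data.Nat.Combinatorics using (_C_)
open import Data.List using (List; []; _∷_; _++_; map; concatMap; length; filter; upTo; zip; foldr)
open import Data.Bool.ListAction using (any; all)
open import Data.Product using (_×_; _,_)
open import Data.Integer as ℤ using (ℤ; +_; -_)

_==_ : Bool → Bool → Bool
true  == b = b
false == b = not b

words : ℕ → ℕ → List (List ℕ)
words zero    n = [] ∷ []
words (suc m) n = concatMap (λ w → map (_∷ w) (upTo n)) (words m n)

elemᵇ : ℕ → List ℕ → Bool
elemᵇ a []      = false
elemᵇ a (b ∷ w) = if a ≡ᵇ b then true else elemᵇ a w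

distinct : List ℕ → Bool
distinct []      = true
distinct (a ∷ w) = not (elemᵇ a w) ∧ distinct w

-- S_n: the permutations of {0,…,n-1}, written in one-line notation
-- (a word of length n over {0,…,n-1} with distinct entries)
isPerm : ℕ → List ℕ → Bool
isPerm n w = distinct w

subseqs : List ℕ → List (List ℕ)
subseqs []      = [] ∷ []
subseqs (a ∷ w) = map (a ∷_) (subseqs w) ++ subseqs w

orderIso : List ℕ → List ℕ → Bool
orderIso s t = (length s ≡ᵇ length t) ∧
  all (λ { (a , b) → all (λ { (c , e) → (a <ᵇ c) == (b <ᵇ e) }) (zip s t) }) (zip s t)

contains : List ℕ → List ℕ → Bool
contains α τ = any (λ s → orderIso s τ) (subseqs α)

avoids : List ℕ → List ℕ → Bool
avoids α τ = not (contains α τ)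

countᵇ : (List ℕ → Bool) → List (List ℕ) → ℕ
countᵇ p []       = 0
countᵇ p (w ∷ ws) = if p w then suc (countᵇ p ws) else countᵇ p ws

avoidCount : List (List ℕ) → ℕ → ℕ
avoidCount ps n =
  countᵇ (λ w → isPerm n w ∧ all (avoids w) ps) (words n n)

patternKD : ℕ → ℕ → List ℕ
patternKD k d =
  map (λ i → suc d + i) (upTo (k ∸ 1 ∸ d)) ++ (1 ∷ k ∷ map (λ i → 2 + i) (upTo (d ∸ 1)))

X3 : ℕ → ℕ → List (List ℕ)
X3 k d = (3 ∷ 2 ∷ 1 ∷ []) ∷ patternKD k d ∷ []

x3 : ℕ → ℕ → ℕ → ℕ
x3 k d n = avoidCount (X3 k d) n

sumTo : ℕ → (ℕ → ℤ) → ℤ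
sumTo n f = foldr (λ i acc → f i ℤ.+ acc) (+ 0) (upTo (suc n))

sign : ℕ → ℤ
sign zero    = + 1
sign (suc j) = - sign j

FPS : Set
FPS = ℕ → ℤ

_⊛_ : FPS → FPS → FPS
(f ⊛ g) n = sumTo n (λ i → f i ℤ.* g (n ∸ i))

shiftX : FPS → FPS
shiftX f zero    = + 0
shiftX f (suc i) = f i

δ₀ : FPS
δ₀ zero    = + 1
δ₀ (suc i) = + 0

-- Ũ m = (√x)^m · U_m(1/(2√x)), a polynomial in x, via the Chebyshev
-- recurrence U_{m+2}(y) = 2y U_{m+1}(y) - U_m(y), U_0 = 1, U_1 = 2y:
-- Ũ 0 = 1, Ũ 1 = 1, Ũ (m+2) = Ũ (m+1) - x Ũ m.
Ũ : ℕ → FPS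
Ũ zero          = δ₀
Ũ (suc zero)    = δ₀
Ũ (suc (suc m)) i = Ũ (suc m) i ℤ.- shiftX (Ũ m) i

{-# OPTIONS --safe #-}
-- Write k = a + b with b = d, and let S_n permute {0,…,n-1}.  In a 321-avoiding
-- permutation the second pattern occurs as soon as there are entries T…T y t B…B (a-1 and b-1
-- letters) in which each of T…T t exceeds each of y B…B.  Let Q₀(n) count the avoiders in S_n, let
-- Q_s(n) for 1 ≤ s ≤ b+1 count those with first entry ≥ s-1, and let Q_{b+i}(n) count those with
-- the first i entries ≥ b.  Removing and reinserting a first entry smaller than b, or an entry 0
-- preceded by fewer than a-1 entries or by a single entry smaller than b, does not affect the
-- occurrences, which yields
--   Q_{s+1}(n) = Q_s(n) - Q_{s-1}(n-1)   for 1 ≤ s ≤ k - 2.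
-- If the first a-1 entries are ≥ b then 0 is immediately followed by 1, and deleting 0 gives
-- Q_{k-1}(n) = Q_{k-2}(n-1).  Since Ũ satisfies the same recursion, the generating function F of
-- Q₀ satisfies F Ũ_s = ΣQ_s(n)xⁿ + Ũ_{s-1} for s < k, and finally F Ũ_k = Ũ_{k-1}.  Below
-- degree k the Q_s(n) obey the recursion and boundary values of the ballot numbers.
module Submission where

open import Defs
open import Data.Bool using (Bool; true; false; T; _∧_; not)
open import Data.Bool.ListAction using (all)
open import Data.Bool.Properties using (T-∧; T?; T-≡; ∧-identityʳ; ∧-zeroʳ)
open import Data.Empty using (⊥; ⊥-elim)
open import Data.Integer as ℤ using (ℤ; +_)
import Data.Integer.Properties as ℤₚ
import Data.Integer.Solver as ℤ-Solver
open import Data.List using (List; []; _∷_; _++_; map; concatMap; cartesianProductWith; length; zip; upTo; applyUpTo; foldr; take; drop; filter)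
import Data.List.Properties as Listₚ
open import Data.List.Membership.Propositional using (_∈_; _∉_; find)
open import Data.List.Membership.Propositional.Properties
open import Data.List.Relation.Binary.Sublist.Propositional using (_⊆_; []; _∷_; _∷ʳ_; ⊆-refl; ⊆-trans; from∈; lookup; minimum)
open import Data.List.Relation.Binary.Sublist.Propositional.Properties using (All-resp-⊆; take-⊆; filter-⊆; length-mono-≤)
  renaming (map⁺ to map-⊆; ++⁺ to ++-⊆; ++⁺ˡ to ++-⊆ˡ; ++⁺ʳ to ++-⊆ʳ)
open import Data.List.Relation.Unary.All as All using (All; []; _∷_)
import Data.List.Relation.Unary.All.Properties as Allₚ
open import Data.List.Relation.Unary.AllPairs as AllPairs using (AllPairs; []; _∷_)
import Data.List.Relation.Unary.AllPairs.Properties as AllPairsₚ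
open import Data.List.Relation.Unary.Any as Any using (here; there)
open import Data.List.Relation.Unary.Any.Properties using (any⁺; any⁻)
open import Data.List.Relation.Unary.Unique.Propositional using (Unique)
import Data.List.Relation.Unary.Unique.Propositional.Properties as Uniqueₚ
open import Data.Nat using (ℕ; zero; suc; pred; _+_; _*_; _∸_; _⊓_; _≤_; _<_; _≡ᵇ_; _<ᵇ_; z≤n; s≤s; _≤?_; _<?_; _≟_)
open import Data.Nat.Combinatorics using (_C_; nC1≡n; nCk+nC[k+1]≡[n+1]C[k+1]; nCk≡nC[n∸k])
open import Data.Nat.DivMod using (_/_; m*n/n≡m)
import Data.Nat.Properties as ℕₚ
open import Data.Nat.Solver using (module +-*-Solver)
open import Data.List.Membership.DecPropositional _≟_ using (_∈?_)
open import Data.Product using (_×_; _,_; proj₁; proj₂; ∃₂; ∃-syntax)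
open import Data.Sum using (_⊎_; inj₁; inj₂; [_,_]′)
open import Data.Unit using (⊤; tt)
open import Function using (_∘_; Equivalence)
open import Relation.Binary using (Rel)
open import Relation.Binary.PropositionalEquality hiding ([_])
open import Relation.Nullary using (¬_; Dec; yes; no; does; contradiction; _×-dec_; ¬?)
open import Relation.Unary using (Decidable)
open ≡-Reasoning

-- Finite sums and convolution

-- Why reinsertion is harmless: each of the leading letters T lies above b distinct letters, so a
-- first entry below b is not one of them. An entry 0 is neither a T nor t, and among the B it would
-- complete a 321 with some T and y. As y it needs a-1 entries before it, and a single predecessor
-- below b is too small to lie above both 0 and the b-1 letters B. The obstacle is that neither
-- deletion alone yields the recursion. Entries before 0 increase, so a first entry v with 1 ≤ v < b
-- is followed by a larger entry or by 0. Deleting v in the former case leaves a first entry ≥ v,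
-- deleting 0 in the latter leaves first entry v-1, and only together do they fill the class "first
-- entry ≥ v-1". Past b, deleting 0 lowers the threshold from b to b-1, a class outside the chain;
-- comparing two splittings shows that, for 1 ≤ i < a-1, "the first i+1 entries are ≥ b-1" is as
-- frequent as "the first i entries are ≥ b". The bounds on d say that at least one T and one B
-- exist, which rules out descents within either group of letters.

∑ : ℕ → (ℕ → ℤ) → ℤ
∑ zero    f = + 0
∑ (suc n) f = f 0 ℤ.+ ∑ n (f ∘ suc)

foldr-applyUpTo : ∀ (f : ℕ → ℤ) g n →
  foldr (λ i acc → f i ℤ.+ acc) (+ 0) (applyUpTo g n) ≡ ∑ n (f ∘ g)
foldr-applyUpTo f g zero    = refl
foldr-applyUpTo f g (suc n) = cong (ℤ._+_ (f (g 0))) (foldr-applyUpTo f (g ∘ suc) n)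

sumTo≡∑ : ∀ n f → sumTo n f ≡ ∑ (suc n) f
sumTo≡∑ n f = foldr-applyUpTo f (λ i → i) (suc n)

∑-cong : ∀ n {f g} → (∀ i → i < n → f i ≡ g i) → ∑ n f ≡ ∑ n g
∑-cong zero    f≡g = refl
∑-cong (suc n) f≡g = cong₂ ℤ._+_ (f≡g 0 (s≤s z≤n)) (∑-cong n λ i i<n → f≡g (suc i) (s≤s i<n))

∑-last : ∀ n f → ∑ (suc n) f ≡ ∑ n f ℤ.+ f n
∑-last zero    f = ℤₚ.+-comm (f 0) (+ 0)
∑-last (suc n) f = begin
  f 0 ℤ.+ ∑ (suc n) (f ∘ suc)           ≡⟨ cong (ℤ._+_ (f 0)) (∑-last n (f ∘ suc)) ⟩
  f 0 ℤ.+ (∑ n (f ∘ suc) ℤ.+ f (suc n)) ≡⟨ ℤₚ.+-assoc (f 0) _ _ ⟨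
  ∑ (suc n) f ℤ.+ f (suc n)             ∎

∑-reverse : ∀ n f → ∑ (suc n) f ≡ ∑ (suc n) (λ i → f (n ∸ i))
∑-reverse zero    f = refl
∑-reverse (suc n) f = begin
  ∑ (suc (suc n)) f                           ≡⟨ ∑-last (suc n) f ⟩
  ∑ (suc n) f ℤ.+ f (suc n)                   ≡⟨ ℤₚ.+-comm _ (f (suc n)) ⟩
  f (suc n) ℤ.+ ∑ (suc n) f                   ≡⟨ cong (ℤ._+_ (f (suc n))) (∑-reverse n f) ⟩
  f (suc n) ℤ.+ ∑ (suc n) (λ i → f (n ∸ i))   ∎

∑-zero : ∀ n → ∑ n (λ _ → + 0) ≡ + 0
∑-zero zero    = refl
∑-zero (suc n) = trans (ℤₚ.+-identityˡ _) (∑-zero n)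

∑-truncate : ∀ n m f → (∀ i → n ≤ i → f i ≡ + 0) → ∑ (n + m) f ≡ ∑ n f
∑-truncate zero    m f f≡0 = trans (∑-cong m λ i _ → f≡0 i z≤n) (∑-zero m)
∑-truncate (suc n) m f f≡0 = cong (ℤ._+_ (f 0)) (∑-truncate n m (f ∘ suc) λ i n≤i → f≡0 (suc i) (s≤s n≤i))

∑-minus : ∀ n f g → ∑ n (λ i → f i ℤ.- g i) ≡ ∑ n f ℤ.- ∑ n g
∑-minus zero    f g = refl
∑-minus (suc n) f g = begin
  f 0 ℤ.- g 0 ℤ.+ ∑ n (λ i → f (suc i) ℤ.- g (suc i))
    ≡⟨ cong (ℤ._+_ (f 0 ℤ.- g 0)) (∑-minus n (f ∘ suc) (g ∘ suc)) ⟩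
  f 0 ℤ.- g 0 ℤ.+ (∑ n (f ∘ suc) ℤ.- ∑ n (g ∘ suc))
    ≡⟨ solve 4 (λ a b c d → (a :- b) :+ (c :- d) := (a :+ c) :- (b :+ d)) refl
         (f 0) (g 0) (∑ n (f ∘ suc)) (∑ n (g ∘ suc)) ⟩
  ∑ (suc n) f ℤ.- ∑ (suc n) g ∎
  where open ℤ-Solver.+-*-Solver

⊛≡∑ : ∀ f g n → (f ⊛ g) n ≡ ∑ (suc n) (λ i → f i ℤ.* g (n ∸ i))
⊛≡∑ f g n = sumTo≡∑ n (λ i → f i ℤ.* g (n ∸ i))

⊛-minus : ∀ f g h n → (f ⊛ (λ i → g i ℤ.- h i)) n ≡ (f ⊛ g) n ℤ.- (f ⊛ h) n
⊛-minus f g h n = begin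
  (f ⊛ (λ i → g i ℤ.- h i)) n
    ≡⟨ ⊛≡∑ f (λ i → g i ℤ.- h i) n ⟩
  ∑ (suc n) (λ i → f i ℤ.* (g (n ∸ i) ℤ.- h (n ∸ i)))
    ≡⟨ ∑-cong (suc n) (λ i _ → solve 3 (λ a b c → a :* (b :- c) := a :* b :- a :* c) refl (f i) (g (n ∸ i)) (h (n ∸ i))) ⟩
  ∑ (suc n) (λ i → f i ℤ.* g (n ∸ i) ℤ.- f i ℤ.* h (n ∸ i))
    ≡⟨ ∑-minus (suc n) (λ i → f i ℤ.* g (n ∸ i)) (λ i → f i ℤ.* h (n ∸ i)) ⟩
  ∑ (suc n) (λ i → f i ℤ.* g (n ∸ i)) ℤ.- ∑ (suc n) (λ i → f i ℤ.* h (n ∸ i))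
    ≡⟨ cong₂ ℤ._-_ (⊛≡∑ f g n) (⊛≡∑ f h n) ⟨
  (f ⊛ g) n ℤ.- (f ⊛ h) n ∎
  where open ℤ-Solver.+-*-Solver

⊛-reverse : ∀ f g n → (f ⊛ g) n ≡ ∑ (suc n) (λ i → g i ℤ.* f (n ∸ i))
⊛-reverse f g n = begin
  (f ⊛ g) n                                              ≡⟨ ⊛≡∑ f g n ⟩
  ∑ (suc n) (λ i → f i ℤ.* g (n ∸ i))                    ≡⟨ ∑-reverse n (λ i → f i ℤ.* g (n ∸ i)) ⟩
  ∑ (suc n) (λ i → f (n ∸ i) ℤ.* g (n ∸ (n ∸ i)))        ≡⟨ ∑-cong (suc n) swap ⟩
  ∑ (suc n) (λ i → g i ℤ.* f (n ∸ i))                    ∎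
  where
  swap : ∀ i → i < suc n → f (n ∸ i) ℤ.* g (n ∸ (n ∸ i)) ≡ g i ℤ.* f (n ∸ i)
  swap i (s≤s i≤n) = trans (ℤₚ.*-comm (f (n ∸ i)) _)
    (cong (λ j → g j ℤ.* f (n ∸ i)) (ℕₚ.m∸[m∸n]≡n i≤n))

⊛-shiftX : ∀ f g n → (f ⊛ shiftX g) n ≡ shiftX (f ⊛ g) n
⊛-shiftX f g zero    = trans (ℤₚ.+-identityʳ _) (ℤₚ.*-zeroʳ (f 0))
⊛-shiftX f g (suc n) = begin
  (f ⊛ shiftX g) (suc n)
    ≡⟨ ⊛-reverse f (shiftX g) (suc n) ⟩
  + 0 ℤ.* f (suc n) ℤ.+ ∑ (suc n) (λ i → g i ℤ.* f (n ∸ i))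
    ≡⟨ cong (λ z → z ℤ.+ ∑ (suc n) (λ i → g i ℤ.* f (n ∸ i))) (ℤₚ.*-zeroˡ (f (suc n))) ⟩
  + 0 ℤ.+ ∑ (suc n) (λ i → g i ℤ.* f (n ∸ i))
    ≡⟨ ℤₚ.+-identityˡ _ ⟩
  ∑ (suc n) (λ i → g i ℤ.* f (n ∸ i))
    ≡⟨ ⊛-reverse f g n ⟨
  (f ⊛ g) n ∎

⊛-δ₀ : ∀ f n → (f ⊛ δ₀) n ≡ f n
⊛-δ₀ f n = begin
  (f ⊛ δ₀) n                                          ≡⟨ ⊛-reverse f δ₀ n ⟩
  + 1 ℤ.* f n ℤ.+ ∑ n (λ i → + 0 ℤ.* f (n ∸ suc i))   ≡⟨ cong₂ ℤ._+_ (ℤₚ.*-identityˡ (f n)) rest ⟩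
  f n ℤ.+ + 0                                         ≡⟨ ℤₚ.+-identityʳ (f n) ⟩
  f n                                                 ∎
  where
  rest = trans (∑-cong n λ i _ → ℤₚ.*-zeroˡ (f (n ∸ suc i))) (∑-zero n)

⊛-Ũ : ∀ f m n → (f ⊛ Ũ (suc (suc m))) n ≡ (f ⊛ Ũ (suc m)) n ℤ.- shiftX (f ⊛ Ũ m) n
⊛-Ũ f m n = trans (⊛-minus f (Ũ (suc m)) (shiftX (Ũ m)) n)
  (cong (λ z → (f ⊛ Ũ (suc m)) n ℤ.- z) (⊛-shiftX f (Ũ m) n))

-- The Chebyshev recurrence becomes Pascal's rule for the numbers `(m ∸ j) C j`.
Ũ-closed : ∀ m j → Ũ m j ≡ sign j ℤ.* + ((m ∸ j) C j)
Ũ-closed zero          zero          = refl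
Ũ-closed zero          (suc j)       = sym (ℤₚ.*-zeroʳ (sign (suc j)))
Ũ-closed (suc zero)    zero          = refl
Ũ-closed (suc zero)    (suc zero)    = refl
Ũ-closed (suc zero)    (suc (suc j)) = sym (ℤₚ.*-zeroʳ (sign (suc (suc j))))
Ũ-closed (suc (suc m)) zero          = cong (ℤ._- + 0) (Ũ-closed (suc m) zero)
Ũ-closed (suc (suc m)) (suc j)       = begin
  Ũ (suc m) (suc j) ℤ.- Ũ m j
    ≡⟨ cong₂ ℤ._-_ (Ũ-closed (suc m) (suc j)) (Ũ-closed m j) ⟩
  ℤ.- sign j ℤ.* + ((m ∸ j) C suc j) ℤ.- sign j ℤ.* + ((m ∸ j) C j)
    ≡⟨ solve 3 (λ s x y → (:- s :* x) :- s :* y := :- s :* (y :+ x)) refl (sign j) (+ ((m ∸ j) C suc j)) (+ ((m ∸ j) C j)) ⟩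
  ℤ.- sign j ℤ.* + ((m ∸ j) C j + (m ∸ j) C suc j)
    ≡⟨ cong (λ z → ℤ.- sign j ℤ.* + z) (pascal m j) ⟩
  ℤ.- sign j ℤ.* + ((suc m ∸ j) C suc j) ∎
  where
  open ℤ-Solver.+-*-Solver
  pascal : ∀ m j → (m ∸ j) C j + (m ∸ j) C suc j ≡ (suc m ∸ j) C suc j
  pascal m j with j ℕₚ.≤? m
  ... | yes j≤m = trans (nCk+nC[k+1]≡[n+1]C[k+1] (m ∸ j) j) (cong (_C suc j) (sym (ℕₚ.+-∸-assoc 1 j≤m)))
  -- Here truncation makes every upper index 0, and `0 C j` vanishes because j is positive.
  ... | no j≰m rewrite ℕₚ.m≤n⇒m∸n≡0 (ℕₚ.≰⇒> j≰m) | ℕₚ.m≤n⇒m∸n≡0 (ℕₚ.<⇒≤ (ℕₚ.≰⇒> j≰m)) with j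
  ...   | zero  = contradiction z≤n j≰m
  ...   | suc _ = refl

Ũ-vanish : ∀ m j → m < j → Ũ m j ≡ + 0
Ũ-vanish m (suc j) m<j = trans (Ũ-closed m (suc j))
  (trans (cong (λ l → sign (suc j) ℤ.* + (l C suc j)) (ℕₚ.m≤n⇒m∸n≡0 (ℕₚ.<⇒≤ m<j)))
         (ℤₚ.*-zeroʳ (sign (suc j))))

-- `Ũ k` has no coefficient beyond degree k, so for k ≤ n the sum stopped at k is the whole
-- convolution.
⊛-Ũ-closed : ∀ (x : ℕ → ℕ) k n → k ≤ n →
  sumTo k (λ j → sign j ℤ.* ((+ ((k ∸ j) C j)) ℤ.* (+ x (n ∸ j)))) ≡ ((λ i → + x i) ⊛ Ũ k) n
⊛-Ũ-closed x k n k≤n = begin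
  sumTo k (λ j → sign j ℤ.* (+ ((k ∸ j) C j) ℤ.* + x (n ∸ j)))
    ≡⟨ sumTo≡∑ k (λ j → sign j ℤ.* (+ ((k ∸ j) C j) ℤ.* + x (n ∸ j))) ⟩
  ∑ (suc k) (λ j → sign j ℤ.* (+ ((k ∸ j) C j) ℤ.* + x (n ∸ j)))
    ≡⟨ ∑-cong (suc k) (λ j _ → trans (sym (ℤₚ.*-assoc (sign j) _ _))
         (cong (ℤ._* + x (n ∸ j)) (sym (Ũ-closed k j)))) ⟩
  ∑ (suc k) (λ j → Ũ k j ℤ.* + x (n ∸ j))
    ≡⟨ ∑-truncate (suc k) (n ∸ k) _ (λ j k<j →
         trans (cong (ℤ._* + x (n ∸ j)) (Ũ-vanish k j k<j)) (ℤₚ.*-zeroˡ (+ x (n ∸ j)))) ⟨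
  ∑ (suc (k + (n ∸ k))) (λ j → Ũ k j ℤ.* + x (n ∸ j))
    ≡⟨ cong (λ N → ∑ (suc N) (λ j → Ũ k j ℤ.* + x (n ∸ j))) (ℕₚ.m+[n∸m]≡n k≤n) ⟩
  ∑ (suc n) (λ j → Ũ k j ℤ.* + x (n ∸ j))
    ≡⟨ ⊛-reverse (λ i → + x i) (Ũ k) n ⟨
  ((λ i → + x i) ⊛ Ũ k) n ∎

-- Ballot numbers

-- ballot s m is the coefficient of x^m in C(x)^(s+1), C(x) the Catalan series.
ballot : ℕ → ℕ → ℕ
ballot s       zero    = 1
ballot zero    (suc m) = ballot 1 m
ballot (suc s) (suc m) = ballot (suc (suc s)) m + ballot s (suc m)

-- n C (k ∸ 1), except that it vanishes at k = 0
_C⁻_ : ℕ → ℕ → ℕ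
n C⁻ zero  = 0
n C⁻ suc k = n C k

pascal⁻ : ∀ n k → n C⁻ k + n C k ≡ suc n C k
pascal⁻ n zero    = refl
pascal⁻ n (suc k) = nCk+nC[k+1]≡[n+1]C[k+1] n k

-- The reflection formula for ballot numbers, written additively to stay in ℕ. The recursion is
-- Pascal's rule; at s = 0 the symmetry of row 2m+1 says that the ballot number for s = -1 would be
-- 0.
ballot-binomial : ∀ m s n → n ≡ m + m + s → ballot s m + n C⁻ m ≡ n C m
ballot-binomial zero    s       n _    = refl
ballot-binomial (suc m) zero    n n≡   = begin
  ballot 1 m + n C m               ≡⟨ cong (λ l → ballot 1 m + l C m) n≡1+n′ ⟩
  ballot 1 m + suc n′ C m          ≡⟨ cong (_+_ (ballot 1 m)) (pascal⁻ n′ m) ⟨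
  ballot 1 m + (n′ C⁻ m + n′ C m)  ≡⟨ ℕₚ.+-assoc (ballot 1 m) _ _ ⟨
  ballot 1 m + n′ C⁻ m + n′ C m    ≡⟨ cong₂ _+_ (ballot-binomial m 1 n′ refl) symmetric ⟩
  n′ C m + n′ C suc m              ≡⟨ nCk+nC[k+1]≡[n+1]C[k+1] n′ m ⟩
  suc n′ C suc m                   ≡⟨ cong (_C suc m) n≡1+n′ ⟨
  n C suc m                        ∎
  where
  open +-*-Solver
  n′ = m + m + 1
  n≡1+n′ : n ≡ suc n′
  n≡1+n′ = trans n≡ (solve 1 (λ m → (con 1 :+ m) :+ (con 1 :+ m) :+ con 0 := con 1 :+ (m :+ m :+ con 1)) refl m)
  n′≡ : n′ ≡ m + suc m
  n′≡ = trans (ℕₚ.+-assoc m m 1) (cong (_+_ m) (ℕₚ.+-comm m 1))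
  symmetric : n′ C m ≡ n′ C suc m
  symmetric = trans (nCk≡nC[n∸k] (ℕₚ.≤-trans (ℕₚ.m≤m+n m (suc m)) (ℕₚ.≤-reflexive (sym n′≡))))
    (cong (n′ C_) (trans (cong (_∸ m) n′≡) (ℕₚ.m+n∸m≡n m (suc m))))
ballot-binomial (suc m) (suc s) n n≡ = begin
  ballot (suc (suc s)) m + ballot s (suc m) + n C m
    ≡⟨ cong (λ l → ballot (suc (suc s)) m + ballot s (suc m) + l C m) n≡1+n′ ⟩
  ballot (suc (suc s)) m + ballot s (suc m) + suc n′ C m
    ≡⟨ cong (_+_ (ballot (suc (suc s)) m + ballot s (suc m))) (pascal⁻ n′ m) ⟨
  ballot (suc (suc s)) m + ballot s (suc m) + (n′ C⁻ m + n′ C m)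
    ≡⟨ solve 4 (λ a b c d → a :+ b :+ (c :+ d) := (a :+ c) :+ (b :+ d)) refl (ballot (suc (suc s)) m) (ballot s (suc m)) (n′ C⁻ m) (n′ C m) ⟩
  (ballot (suc (suc s)) m + n′ C⁻ m) + (ballot s (suc m) + n′ C m)
    ≡⟨ cong₂ _+_ (ballot-binomial m (suc (suc s)) n′ n′≡) (ballot-binomial (suc m) s n′ refl) ⟩
  n′ C m + n′ C suc m
    ≡⟨ nCk+nC[k+1]≡[n+1]C[k+1] n′ m ⟩
  suc n′ C suc m
    ≡⟨ cong (_C suc m) n≡1+n′ ⟨
  n C suc m ∎
  where
  open +-*-Solver
  n′ = suc m + suc m + s
  n≡1+n′ : n ≡ suc n′
  n≡1+n′ = trans n≡ (ℕₚ.+-suc (suc m + suc m) s)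
  n′≡ : n′ ≡ m + m + suc (suc s)
  n′≡ = solve 2 (λ m s → (con 1 :+ m) :+ (con 1 :+ m) :+ s := m :+ m :+ (con 2 :+ s)) refl m s

absorption : ∀ n k → suc k * (suc n C suc k) ≡ suc n * (n C k)
absorption zero    zero    = refl
absorption zero    (suc k) = ℕₚ.*-zeroʳ k
absorption (suc n) zero    = begin
  1 * (suc (suc n) C 1)         ≡⟨ ℕₚ.*-identityˡ _ ⟩
  suc (suc n) C 1               ≡⟨ nC1≡n (suc (suc n)) ⟩
  suc (suc n)                   ≡⟨ ℕₚ.*-identityʳ _ ⟨
  suc (suc n) * 1               ∎
absorption (suc n) (suc k) = begin
  suc (suc k) * (suc (suc n) C suc (suc k))
    ≡⟨ cong (suc (suc k) *_) (nCk+nC[k+1]≡[n+1]C[k+1] (suc n) (suc k)) ⟨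
  suc (suc k) * (c + suc n C suc (suc k))
    ≡⟨ solve 3 (λ k c e → (con 2 :+ k) :* (c :+ e) := (con 1 :+ k) :* c :+ c :+ (con 2 :+ k) :* e) refl
         k c (suc n C suc (suc k)) ⟩
  suc k * c + c + suc (suc k) * (suc n C suc (suc k))
    ≡⟨ cong₂ (λ u v → u + c + v) (absorption n k) (absorption n (suc k)) ⟩
  suc n * (n C k) + c + suc n * (n C suc k)
    ≡⟨ solve 4 (λ n c p q → (con 1 :+ n) :* p :+ c :+ (con 1 :+ n) :* q := (con 1 :+ n) :* (p :+ q) :+ c) refl
         n c (n C k) (n C suc k) ⟩
  suc n * (n C k + n C suc k) + c
    ≡⟨ cong (λ z → suc n * z + c) (nCk+nC[k+1]≡[n+1]C[k+1] n k) ⟩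
  suc n * c + c
    ≡⟨ ℕₚ.+-comm _ c ⟩
  suc (suc n) * c ∎
  where
  open +-*-Solver
  c = suc n C suc k

descending : ∀ j k → suc k * ((j + k) C suc k) ≡ j * ((j + k) C k)
descending j k = ℕₚ.+-cancelˡ-≡ (suc k * (n C k)) _ _ (begin
  suc k * (n C k) + suc k * (n C suc k)  ≡⟨ ℕₚ.*-distribˡ-+ (suc k) (n C k) (n C suc k) ⟨
  suc k * (n C k + n C suc k)            ≡⟨ cong (suc k *_) (nCk+nC[k+1]≡[n+1]C[k+1] n k) ⟩
  suc k * (suc n C suc k)                ≡⟨ absorption n k ⟩
  suc n * (n C k)                        ≡⟨ cong (_* (n C k)) (cong suc (ℕₚ.+-comm j k)) ⟩
  (suc k + j) * (n C k)                  ≡⟨ ℕₚ.*-distribʳ-+ (n C k) (suc k) j ⟩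
  suc k * (n C k) + j * (n C k)          ∎)
  where n = j + k

catalan : ∀ n → ballot 0 n ≡ ((2 * n) C n) / suc n
catalan zero    = refl
catalan (suc m) = begin
  b                   ≡⟨ m*n/n≡m b (suc (suc m)) ⟨
  b * suc (suc m) / suc (suc m)  ≡⟨ cong (_/ suc (suc m)) b*[m+2]≡ ⟩
  (n C suc m) / suc (suc m)      ≡⟨⟩
  ((2 * suc m) C suc m) / suc (suc m) ∎
  where
  n = 2 * suc m
  b = ballot 0 (suc m)
  n≡ : n ≡ suc (suc m) + m
  n≡ = solve 1 (λ m → con 2 :* (con 1 :+ m) := con 2 :+ m :+ m) refl m
    where open +-*-Solver
  b+ : b + n C m ≡ n C suc m
  b+ = ballot-binomial (suc m) 0 n (trans (cong (_+_ (suc m)) (ℕₚ.+-identityʳ (suc m))) (sym (ℕₚ.+-identityʳ _)))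
  desc : suc m * (n C suc m) ≡ suc (suc m) * (n C m)
  desc = subst (λ l → suc m * (l C suc m) ≡ suc (suc m) * (l C m)) (sym n≡) (descending (suc (suc m)) m)
  b*[m+2]≡ : b * suc (suc m) ≡ n C suc m
  -- After adding `suc m * (n C suc m)`, the claim is m+2 times the identity `b+`.
  b*[m+2]≡ = ℕₚ.+-cancelʳ-≡ (suc m * (n C suc m)) _ _ (begin
    b * suc (suc m) + suc m * (n C suc m)       ≡⟨ cong₂ _+_ (ℕₚ.*-comm b (suc (suc m))) desc ⟩
    suc (suc m) * b + suc (suc m) * (n C m)     ≡⟨ ℕₚ.*-distribˡ-+ (suc (suc m)) b (n C m) ⟨
    suc (suc m) * (b + n C m)                   ≡⟨ cong (suc (suc m) *_) b+ ⟩
    suc (suc m) * (n C suc m)                   ∎)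

-- From the recursion of Q to the three conclusions

-- `K` stands for k-2. `Q 0` and `Q 1` differ only at the empty permutation, which has no first
-- entry; that single difference produces the term `Ũ⁻` below.
module Chain (K : ℕ) (Q : ℕ → ℕ → ℕ)
  (Q00 : Q 0 0 ≡ 1)
  (Qs0 : ∀ s → Q (suc s) 0 ≡ 0)
  (Q1 : ∀ n → Q 1 (suc n) ≡ Q 0 (suc n))
  (step : ∀ s n → s < K → Q (suc s) (suc n) ≡ Q (suc (suc s)) (suc n) + Q s n)
  (top : ∀ n → Q (suc K) (suc n) ≡ Q K n)
  where

  F : FPS
  F i = + Q 0 i

  Ũ⁻ : ℕ → FPS
  Ũ⁻ zero    _ = + 0
  Ũ⁻ (suc s) = Ũ s

  Ũ⁻-rec : ∀ s n → Ũ⁻ (suc (suc s)) n ≡ Ũ⁻ (suc s) n ℤ.- shiftX (Ũ⁻ s) n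
  Ũ⁻-rec zero    zero    = refl
  Ũ⁻-rec zero    (suc n) = refl
  Ũ⁻-rec (suc s) n       = refl

  -- Both sides obey the same three-term recursion in s. The products and the series of `Q s` agree
  -- at s = 0 and differ by `δ₀` at s = 1, and `Ũ⁻` is the solution with these starting values.
  F⊛Ũ : ∀ s n → s ≤ suc K → (F ⊛ Ũ s) n ≡ + Q s n ℤ.+ Ũ⁻ s n
  F⊛Ũ zero          n       _   = trans (⊛-δ₀ F n) (sym (ℤₚ.+-identityʳ _))
  F⊛Ũ (suc zero)    zero    _   = trans (⊛-δ₀ F 0) (cong +_ (trans Q00 (cong (_+ 1) (sym (Qs0 0)))))
  F⊛Ũ (suc zero)    (suc n) _   = trans (⊛-δ₀ F (suc n)) (trans (cong +_ (sym (Q1 n))) (sym (ℤₚ.+-identityʳ _)))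
  F⊛Ũ (suc (suc s)) n       (s≤s s<K) = begin
    (F ⊛ Ũ (suc (suc s))) n
      ≡⟨ ⊛-Ũ F s n ⟩
    (F ⊛ Ũ (suc s)) n ℤ.- shiftX (F ⊛ Ũ s) n
      ≡⟨ cong (λ z → z ℤ.- shiftX (F ⊛ Ũ s) n) (F⊛Ũ (suc s) n (ℕₚ.m≤n⇒m≤1+n s<K)) ⟩
    + Q (suc s) n ℤ.+ Ũ⁻ (suc s) n ℤ.- shiftX (F ⊛ Ũ s) n
      ≡⟨ split n ⟩
    + Q (suc (suc s)) n ℤ.+ (Ũ⁻ (suc s) n ℤ.- shiftX (Ũ⁻ s) n)
      ≡⟨ cong (λ z → + Q (suc (suc s)) n ℤ.+ z) (Ũ⁻-rec s n) ⟨
    + Q (suc (suc s)) n ℤ.+ Ũ⁻ (suc (suc s)) n ∎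
    where
    open ℤ-Solver.+-*-Solver
    split : ∀ n → + Q (suc s) n ℤ.+ Ũ⁻ (suc s) n ℤ.- shiftX (F ⊛ Ũ s) n
      ≡ + Q (suc (suc s)) n ℤ.+ (Ũ⁻ (suc s) n ℤ.- shiftX (Ũ⁻ s) n)
    split zero rewrite Qs0 s | Qs0 (suc s) = ℤₚ.+-assoc (+ 0) (Ũ⁻ (suc s) 0) (+ 0)
    split (suc n) rewrite step s n s<K | F⊛Ũ s n (ℕₚ.m≤n⇒m≤1+n (ℕₚ.<⇒≤ s<K)) =
      solve 4 (λ a b c d → ((a :+ b) :+ c) :- (b :+ d) := a :+ (c :- d)) refl
        (+ Q (suc (suc s)) (suc n)) (+ Q s n) (Ũ⁻ (suc s) (suc n)) (Ũ⁻ s n)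

  -- By `top`, the recursion continued one index further would give a zero series for `Q`, so only
  -- the `Ũ⁻` part of the product survives.
  generating-function : ∀ n → (F ⊛ Ũ (suc (suc K))) n ≡ Ũ (suc K) n
  generating-function n = begin
    (F ⊛ Ũ (suc (suc K))) n
      ≡⟨ ⊛-Ũ F K n ⟩
    (F ⊛ Ũ (suc K)) n ℤ.- shiftX (F ⊛ Ũ K) n
      ≡⟨ cong (λ z → z ℤ.- shiftX (F ⊛ Ũ K) n) (F⊛Ũ (suc K) n ℕₚ.≤-refl) ⟩
    + Q (suc K) n ℤ.+ Ũ⁻ (suc K) n ℤ.- shiftX (F ⊛ Ũ K) n
      ≡⟨ cancel n ⟩
    Ũ⁻ (suc K) n ℤ.- shiftX (Ũ⁻ K) n
      ≡⟨ Ũ⁻-rec K n ⟨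
    Ũ (suc K) n ∎
    where
    open ℤ-Solver.+-*-Solver
    cancel : ∀ n → + Q (suc K) n ℤ.+ Ũ⁻ (suc K) n ℤ.- shiftX (F ⊛ Ũ K) n
      ≡ Ũ⁻ (suc K) n ℤ.- shiftX (Ũ⁻ K) n
    cancel zero rewrite Qs0 K = cong (ℤ._- + 0) (ℤₚ.+-identityˡ (Ũ⁻ (suc K) 0))
    cancel (suc n) rewrite top n | F⊛Ũ K n (ℕₚ.n≤1+n K) =
      solve 3 (λ a c d → (a :+ c) :- (a :+ d) := c :- d) refl
        (+ Q K n) (Ũ⁻ (suc K) (suc n)) (Ũ⁻ K n)

  recurrence : ∀ n → suc (suc K) ≤ n →
    sumTo (suc (suc K)) (λ j → sign j ℤ.* ((+ ((suc (suc K) ∸ j) C j)) ℤ.* (+ Q 0 (n ∸ j)))) ≡ + 0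
  recurrence n k≤n = begin
    _                       ≡⟨ ⊛-Ũ-closed (Q 0) (suc (suc K)) n k≤n ⟩
    (F ⊛ Ũ (suc (suc K))) n ≡⟨ generating-function n ⟩
    Ũ (suc K) n             ≡⟨ Ũ-vanish (suc K) n k≤n ⟩
    + 0                     ∎

  top′ : ∀ {s} n → suc s + 0 ≡ suc K → Q (suc s) (suc n) ≡ Q s n
  top′ {s} n e = subst (λ l → Q (suc l) (suc n) ≡ Q l n)
    (sym (trans (sym (ℕₚ.+-identityʳ s)) (ℕₚ.suc-injective e))) (top n)

  -- Induction on n and then on t, the distance from s to the end of the chain: `step` raises s at
  -- the same n until `top` reduces n.
  Q-vanish : ∀ n s t → s + t ≡ suc K → n < s → Q s n ≡ 0
  Q-vanish zero    (suc s) t       _  _         = Qs0 s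
  Q-vanish (suc n) (suc s) zero    e  (s≤s n<s)
    = trans (top′ n e) (Q-vanish n s 1 (trans (ℕₚ.+-suc s 0) e) n<s)
  Q-vanish (suc n) (suc s) (suc t) e  (s≤s n<s) =
    trans (step s n (ℕₚ.≤-trans (ℕₚ.m≤m+n (suc s) t) (ℕₚ.≤-reflexive e′)))
      (cong₂ _+_ (Q-vanish (suc n) (suc (suc s)) t (cong suc e′) (s≤s (ℕₚ.m<n⇒m<1+n n<s)))
                 (Q-vanish n s (suc (suc t)) (trans (ℕₚ.+-suc s (suc t)) e) n<s))
    where
    e′ : suc s + t ≡ K
    e′ = trans (sym (ℕₚ.+-suc s t)) (ℕₚ.suc-injective e)

  -- The bound m ≤ t keeps the size s + m at most k-1. Each rise in s at the same size lowers m, so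
  -- `top` is met only when m = 0, and the end of the chain is not felt.
  Q-ballot : ∀ m s t → s + t ≡ suc K → m ≤ t → Q s (s + m) ≡ ballot s m
  Q-ballot zero zero t e _ = Q00
  Q-ballot (suc m) zero (suc t) e (s≤s m≤t) =
    trans (sym (Q1 m)) (Q-ballot m 1 t e m≤t)
  Q-ballot zero (suc s) zero e _
    = trans (top′ (s + 0) e) (Q-ballot zero s 1 (trans (ℕₚ.+-suc s 0) e) z≤n)
  Q-ballot zero (suc s) (suc t) e _ =
    trans (step s (s + 0) (ℕₚ.≤-trans (ℕₚ.m≤m+n (suc s) t) (ℕₚ.≤-reflexive e′)))
      (cong₂ _+_ (Q-vanish (suc (s + 0)) (suc (suc s)) t (cong suc e′)
                   (s≤s (s≤s (ℕₚ.≤-reflexive (ℕₚ.+-identityʳ s)))))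
                 (Q-ballot zero s (suc (suc t)) (trans (ℕₚ.+-suc s (suc t)) e) z≤n))
    where
    e′ : suc s + t ≡ K
    e′ = trans (sym (ℕₚ.+-suc s t)) (ℕₚ.suc-injective e)
  Q-ballot (suc m) (suc s) (suc t) e (s≤s m≤t) =
    trans (step s (s + suc m) (ℕₚ.≤-trans (ℕₚ.m≤m+n (suc s) t) (ℕₚ.≤-reflexive e′)))
      (cong₂ _+_ (trans (cong (λ l → Q (suc (suc s)) (suc l)) (ℕₚ.+-suc s m))
                   (Q-ballot m (suc (suc s)) t (cong suc e′) m≤t))
                 (Q-ballot (suc m) s (suc (suc t)) (trans (ℕₚ.+-suc s (suc t)) e) (s≤s (ℕₚ.m≤n⇒m≤1+n m≤t))))
    where
    e′ : suc s + t ≡ K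
    e′ = trans (sym (ℕₚ.+-suc s t)) (ℕₚ.suc-injective e)

  initial-values : ∀ n → n < suc (suc K) → Q 0 n ≡ ((2 * n) C n) / suc n
  initial-values n (s≤s n≤1+K) = trans (Q-ballot n 0 (suc K) refl n≤1+K) (catalan n)

-- Counting and pattern containment

AllPairs-resp-⊆ : ∀ {a r} {A : Set a} {R : Rel A r} {xs ys} → xs ⊆ ys → AllPairs R ys → AllPairs R xs
AllPairs-resp-⊆ []           []         = []
AllPairs-resp-⊆ (y ∷ʳ τ)     (_ ∷ prs)  = AllPairs-resp-⊆ τ prs
AllPairs-resp-⊆ (refl ∷ τ)   (pr ∷ prs) = All-resp-⊆ τ pr ∷ AllPairs-resp-⊆ τ prs

-- Pigeonhole along an injective relation.
length-≤ : ∀ {a b r} {A : Set a} {B : Set b} (R : A → B → Set r) {xs : List A} {ys : List B} → Unique xs →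
  (∀ {x} → x ∈ xs → ∃[ y ] y ∈ ys × R x y) →
  (∀ {x x′ y} → x ∈ xs → x′ ∈ xs → R x y → R x′ y → x ≡ x′) →
  length xs ≤ length ys
length-≤ R {[]}     _             total inj = z≤n
length-≤ R {x ∷ xs} (x∉xs ∷ xs!) total inj
  with y , y∈ys , Rxy ← total (here refl)
  with ys₁ , ys₂ , refl ← ∈-∃++ y∈ys =
  ℕₚ.≤-trans (s≤s (length-≤ R xs! total′ (λ p q → inj (there p) (there q))))
    (ℕₚ.≤-reflexive (trans (cong suc (Listₚ.length-++ ys₁))
      (trans (sym (ℕₚ.+-suc (length ys₁) (length ys₂))) (sym (Listₚ.length-++ ys₁)))))
  where
  total′ : ∀ {x′} → x′ ∈ xs → ∃[ y′ ] y′ ∈ ys₁ ++ ys₂ × R x′ y′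
  total′ x′∈xs with total (there x′∈xs)
  ... | y′ , y′∈ys , Rx′y′ with ∈-++⁻ ys₁ y′∈ys
  ...   | inj₁ y′∈ys₁           = y′ , ∈-++⁺ˡ y′∈ys₁ , Rx′y′
  ...   | inj₂ (there y′∈ys₂)   = y′ , ∈-++⁺ʳ ys₁ y′∈ys₂ , Rx′y′
  ...   | inj₂ (here refl)      = contradiction (inj (here refl) (there x′∈xs) Rxy Rx′y′) (All.lookup x∉xs x′∈xs)

length-⊆ : ∀ {a} {A : Set a} {xs ys : List A} → Unique xs → (∀ {x} → x ∈ xs → x ∈ ys) → length xs ≤ length ys
length-⊆ xs! sub = length-≤ _≡_ xs! (λ {x} x∈xs → x , sub x∈xs , refl) (λ _ _ p q → trans p (sym q))

countᵇ-filter : ∀ p ws → ∃[ us ] countᵇ p ws ≡ length us × (Unique ws → Unique us)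
  × (∀ {w} → w ∈ us → w ∈ ws × T (p w)) × (∀ {w} → w ∈ ws → T (p w) → w ∈ us)
countᵇ-filter p ws = filter (T? ∘ p) ws , count≡ ws , Uniqueₚ.filter⁺ (T? ∘ p) , ∈-filter⁻ (T? ∘ p) , ∈-filter⁺ (T? ∘ p)
  where
  count≡ : ∀ ws → countᵇ p ws ≡ length (filter (T? ∘ p) ws)
  count≡ []       = refl
  count≡ (w ∷ ws) with p w
  ... | true  = cong suc (count≡ ws)
  ... | false = count≡ ws

module _ (p q : List ℕ → Bool) {us vs : List (List ℕ)} (us! : Unique us) (f g : List ℕ → List ℕ)
  (f-inj : ∀ {w} → w ∈ us → T (p w) → (f w ∈ vs × T (q (f w))) × g (f w) ≡ w) where

  -- The left inverse `g` makes `f` injective on the selected words; it need not invert `f`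
  -- elsewhere.
  countᵇ-≤ : countᵇ p us ≤ countᵇ q vs
  countᵇ-≤ with countᵇ-filter p us | countᵇ-filter q vs
  ... | us′ , eq₁ , unique , ∈⁻ , _ | vs′ , eq₂ , _ , _ , ∈⁺ =
    subst₂ _≤_ (sym eq₁) (sym eq₂) (length-≤ (λ w v → f w ≡ v) (unique us!)
      (λ {w} w∈us′ → let w∈us , pw = ∈⁻ w∈us′ ; (fw∈vs , qfw) , _ = f-inj w∈us pw in f w , ∈⁺ fw∈vs qfw , refl)
      (λ w∈us′ w′∈us′ fw≡ fw′≡ →
        trans (sym (proj₂ (f-inj (proj₁ (∈⁻ w∈us′)) (proj₂ (∈⁻ w∈us′)))))
          (trans (cong g (trans fw≡ (sym fw′≡))) (proj₂ (f-inj (proj₁ (∈⁻ w′∈us′)) (proj₂ (∈⁻ w′∈us′)))))))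

countᵇ-split : ∀ p q r ws → (∀ {w} → w ∈ ws → (T (p w) → T (q w) ⊎ T (r w)) × (T (q w) → T (p w)) × (T (r w) → T (p w)) × ¬ (T (q w) × T (r w))) →
  countᵇ p ws ≡ countᵇ q ws + countᵇ r ws
countᵇ-split p q r []       _ = refl
countᵇ-split p q r (w ∷ ws) h with p w | q w | r w | h {w} (here refl) | countᵇ-split p q r ws (h ∘ there)
... | true  | true  | true  | _ , _ , _ , disj | _  = contradiction (_ , _) disj
... | true  | true  | false | _ | ih = cong suc ih
... | true  | false | true  | _ | ih = trans (cong suc ih) (sym (ℕₚ.+-suc _ _))
... | true  | false | false | cover , _ | _ = [ (λ ()) , (λ ()) ]′ (cover _)
... | false | true  | _     | _ , q⇒p , _ | _ = ⊥-elim (q⇒p _)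
... | false | false | true  | _ , _ , r⇒p , _ | _ = ⊥-elim (r⇒p _)
... | false | false | false | _ | ih = ih

words≡ : ∀ m n → words (suc m) n ≡ cartesianProductWith (λ w a → a ∷ w) (words m n) (upTo n)
words≡ m n = go (words m n)
  where
  go : ∀ ws → concatMap (λ w → map (_∷ w) (upTo n)) ws ≡ cartesianProductWith (λ w a → a ∷ w) ws (upTo n)
  go []       = refl
  go (w ∷ ws) = cong (map (_∷ w) (upTo n) ++_) (go ws)

words-unique : ∀ m n → Unique (words m n)
words-unique zero    n = [] ∷ []
words-unique (suc m) n rewrite words≡ m n =
  Uniqueₚ.cartesianProductWith⁺ _ (λ eq → Listₚ.∷-injectiveʳ eq , Listₚ.∷-injectiveˡ eq) (words-unique m n) (Uniqueₚ.upTo⁺ n)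

∈-words⁻ : ∀ m n {w} → w ∈ words m n → length w ≡ m × All (_< n) w
∈-words⁻ zero    n (here refl) = refl , []
∈-words⁻ (suc m) n w∈ rewrite words≡ m n
  with w , a , w∈ws , a∈ , refl ← ∈-cartesianProductWith⁻ (λ w a → a ∷ w) (words m n) (upTo n) w∈
  with len , bound ← ∈-words⁻ m n w∈ws = cong suc len , ∈-upTo⁻ a∈ ∷ bound

∈-words⁺ : ∀ m n {w} → length w ≡ m → All (_< n) w → w ∈ words m n
∈-words⁺ zero    n {[]}    _   _           = here refl
∈-words⁺ (suc m) n {a ∷ w} len (a<n ∷ w<n) rewrite words≡ m n =
  ∈-cartesianProductWith⁺ (λ w a → a ∷ w) (∈-words⁺ m n (ℕₚ.suc-injective len) w<n) (∈-upTo⁺ a<n)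

elemᵇ-false : ∀ a w → T (not (elemᵇ a w)) → All (a ≢_) w
elemᵇ-false a []      _ = []
elemᵇ-false a (b ∷ w) h with a ≡ᵇ b in eq
... | false = (λ { refl → subst T eq (ℕₚ.≡⇒≡ᵇ a a refl) }) ∷ elemᵇ-false a w h

elemᵇ-false′ : ∀ a w → All (a ≢_) w → T (not (elemᵇ a w))
elemᵇ-false′ a []      _         = _
elemᵇ-false′ a (b ∷ w) (a≢b ∷ h) with a ≡ᵇ b in eq
... | true  = contradiction (ℕₚ.≡ᵇ⇒≡ a b (subst T (sym eq) _)) a≢b
... | false = elemᵇ-false′ a w h

distinct⇒Unique : ∀ w → T (distinct w) → Unique w
distinct⇒Unique []      _ = []
distinct⇒Unique (a ∷ w) h with h₁ , h₂ ← Equivalence.to T-∧ h = elemᵇ-false a w h₁ ∷ distinct⇒Unique w h₂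

Unique⇒distinct : ∀ w → Unique w → T (distinct w)
Unique⇒distinct []      _          = _
Unique⇒distinct (a ∷ w) (a∉w ∷ w!) = Equivalence.from T-∧ (elemᵇ-false′ a w a∉w , Unique⇒distinct w w!)

∈-subseqs⁻ : ∀ w {s} → s ∈ subseqs w → s ⊆ w
∈-subseqs⁻ []      (here refl) = []
∈-subseqs⁻ (a ∷ w) s∈ with ∈-++⁻ (map (a ∷_) (subseqs w)) s∈
... | inj₁ s∈₁ with _ , s′∈ , refl ← ∈-map⁻ (a ∷_) s∈₁ = refl ∷ ∈-subseqs⁻ w s′∈
... | inj₂ s∈₂ = a ∷ʳ ∈-subseqs⁻ w s∈₂

∈-subseqs⁺ : ∀ {s w} → s ⊆ w → s ∈ subseqs w
∈-subseqs⁺ []         = here refl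
∈-subseqs⁺ {w = a ∷ w} (a ∷ʳ τ)   = ∈-++⁺ʳ (map (a ∷_) (subseqs w)) (∈-subseqs⁺ τ)
∈-subseqs⁺ (refl ∷ τ) = ∈-++⁺ˡ (∈-map⁺ _ (∈-subseqs⁺ τ))

Contains : List ℕ → List ℕ → Set
Contains w τ = ∃[ s ] s ⊆ w × T (orderIso s τ)

avoids⁻ : ∀ w τ → T (avoids w τ) → ¬ Contains w τ
avoids⁻ w τ av (s , s⊆w , iso) with contains w τ in eq
... | false = subst T eq (any⁺ (λ s → orderIso s τ) (Any.map (λ { refl → iso }) (∈-subseqs⁺ s⊆w)))

avoids⁺ : ∀ w τ → ¬ Contains w τ → T (avoids w τ)
avoids⁺ w τ ¬c with contains w τ in eq
... | false = _
... | true  with s , s∈ , iso ← find (any⁻ (λ s → orderIso s τ) (subseqs w) (subst T (sym eq) _)) =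
  ¬c (s , ∈-subseqs⁻ w s∈ , iso)

==⇒≡ : ∀ a b → T (a == b) → a ≡ b
==⇒≡ true  true  _ = refl
==⇒≡ false false _ = refl

≡⇒== : ∀ {a b} → a ≡ b → T (a == b)
≡⇒== {true}  refl = _
≡⇒== {false} refl = _

orderIso⁻ : ∀ s t → T (orderIso s t) → length s ≡ length t ×
  (∀ {a b c e} → (a , b) ∈ zip s t → (c , e) ∈ zip s t → (a <ᵇ c) ≡ (b <ᵇ e))
orderIso⁻ s t h with h₁ , h₂ ← Equivalence.to (T-∧ {length s ≡ᵇ length t}) h =
  ℕₚ.≡ᵇ⇒≡ _ _ h₁ ,
  λ p∈ q∈ → ==⇒≡ _ _ (All.lookup (Allₚ.all⁺ _ (zip s t) (All.lookup (Allₚ.all⁺ _ (zip s t) h₂) p∈)) q∈)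

orderIso⁺ : ∀ s t → length s ≡ length t →
  (∀ {a b c e} → (a , b) ∈ zip s t → (c , e) ∈ zip s t → (a <ᵇ c) ≡ (b <ᵇ e)) → T (orderIso s t)
orderIso⁺ s t len h = Equivalence.from (T-∧ {length s ≡ᵇ length t}) (ℕₚ.≡⇒≡ᵇ _ _ len ,
  Allₚ.all⁻ _ (All.tabulate λ p∈ → Allₚ.all⁻ _ (All.tabulate λ q∈ → ≡⇒== (h p∈ q∈))))

<⇒<ᵇ≡true : ∀ {a b} → a < b → (a <ᵇ b) ≡ true
<⇒<ᵇ≡true = Equivalence.to T-≡ ∘ ℕₚ.<⇒<ᵇ

≮⇒<ᵇ≡false : ∀ {a b} → ¬ a < b → (a <ᵇ b) ≡ false
≮⇒<ᵇ≡false {a} {b} a≮b with a <ᵇ b in eq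
... | false = refl
... | true  = contradiction (ℕₚ.<ᵇ⇒< a b (subst T (sym eq) _)) a≮b

<ᵇ-reflects : ∀ {a b c e} → (a <ᵇ c) ≡ (b <ᵇ e) → b < e → a < c
<ᵇ-reflects {a} {c = c} eq b<e = ℕₚ.<ᵇ⇒< a c (subst T (sym eq) (ℕₚ.<⇒<ᵇ b<e))

zip-∈ : ∀ {x} {xs ys : List ℕ} → length xs ≡ length ys → x ∈ xs → ∃[ y ] y ∈ ys × (x , y) ∈ zip xs ys
zip-∈ {ys = y ∷ ys} len (here refl) = y , here refl , here refl
zip-∈ {ys = y ∷ ys} len (there x∈) with y′ , y′∈ , p ← zip-∈ (ℕₚ.suc-injective len) x∈ = y′ , there y′∈ , there p

∈-zipˡ : ∀ {x y} {xs ys : List ℕ} → (x , y) ∈ zip xs ys → x ∈ xs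
∈-zipˡ {xs = _ ∷ _} {_ ∷ _} (here refl) = here refl
∈-zipˡ {xs = _ ∷ _} {_ ∷ _} (there p)   = there (∈-zipˡ p)

∈-zipʳ : ∀ {x y} {xs ys : List ℕ} → (x , y) ∈ zip xs ys → y ∈ ys
∈-zipʳ {xs = _ ∷ _} {_ ∷ _} (here refl) = here refl
∈-zipʳ {xs = _ ∷ _} {_ ∷ _} (there p)   = there (∈-zipʳ p)

zip-++ : ∀ (xs ys {xs′ ys′} : List ℕ) → length xs ≡ length ys → zip (xs ++ xs′) (ys ++ ys′) ≡ zip xs ys ++ zip xs′ ys′
zip-++ []       []       _   = refl
zip-++ (x ∷ xs) (y ∷ ys) len = cong ((x , y) ∷_) (zip-++ xs ys (ℕₚ.suc-injective len))

increasing-iso : ∀ {xs ys} → AllPairs _<_ xs → AllPairs _<_ ys →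
  ∀ {a b c e} → (a , b) ∈ zip xs ys → (c , e) ∈ zip xs ys → (a <ᵇ c) ≡ (b <ᵇ e)
increasing-iso {x ∷ _} {y ∷ _} _ _ (here refl) (here refl) =
  trans (≮⇒<ᵇ≡false (ℕₚ.n≮n x)) (sym (≮⇒<ᵇ≡false (ℕₚ.n≮n y)))
increasing-iso {_ ∷ _} {_ ∷ _} (x< ∷ xs<) (y< ∷ ys<) (here refl) (there q) =
  trans (<⇒<ᵇ≡true (All.lookup x< (∈-zipˡ q))) (sym (<⇒<ᵇ≡true (All.lookup y< (∈-zipʳ q))))
increasing-iso {_ ∷ _} {_ ∷ _} (x< ∷ xs<) (y< ∷ ys<) (there p) (here refl) =
  trans (≮⇒<ᵇ≡false (ℕₚ.<-asym (All.lookup x< (∈-zipˡ p)))) (sym (≮⇒<ᵇ≡false (ℕₚ.<-asym (All.lookup y< (∈-zipʳ p)))))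
increasing-iso {_ ∷ _} {_ ∷ _} (x< ∷ xs<) (y< ∷ ys<) (there p) (there q) = increasing-iso xs< ys< p q

No321 : List ℕ → Set
No321 w = ∀ {c b a} → c ∷ b ∷ a ∷ [] ⊆ w → b < c → a < b → ⊥

321⇒Contains : ∀ {w c b a} → c ∷ b ∷ a ∷ [] ⊆ w → b < c → a < b → Contains w (3 ∷ 2 ∷ 1 ∷ [])
321⇒Contains {c = c} {b} {a} τ b<c a<b = _ , τ , orderIso⁺ (c ∷ b ∷ a ∷ []) (3 ∷ 2 ∷ 1 ∷ []) refl iso
  where
  lt : ∀ {x y} {z : Bool} → x < y → true ≡ z → (x <ᵇ y) ≡ z
  lt x<y eq = trans (<⇒<ᵇ≡true x<y) eq
  ge : ∀ {x y} {z : Bool} → ¬ x < y → false ≡ z → (x <ᵇ y) ≡ z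
  ge x≮y eq = trans (≮⇒<ᵇ≡false x≮y) eq
  a<c = ℕₚ.<-trans a<b b<c
  iso : ∀ {x y z w} → (x , y) ∈ zip (c ∷ b ∷ a ∷ []) (3 ∷ 2 ∷ 1 ∷ []) → (z , w) ∈ zip (c ∷ b ∷ a ∷ []) (3 ∷ 2 ∷ 1 ∷ []) → (x <ᵇ z) ≡ (y <ᵇ w)
  iso (here refl) (here refl) = ge (ℕₚ.n≮n c) refl
  iso (here refl) (there (here refl)) = ge (ℕₚ.<-asym b<c) refl
  iso (here refl) (there (there (here refl))) = ge (ℕₚ.<-asym a<c) refl
  iso (there (here refl)) (here refl) = lt b<c refl
  iso (there (here refl)) (there (here refl)) = ge (ℕₚ.n≮n b) refl
  iso (there (here refl)) (there (there (here refl))) = ge (ℕₚ.<-asym a<b) refl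
  iso (there (there (here refl))) (here refl) = lt a<c refl
  iso (there (there (here refl))) (there (here refl)) = lt a<b refl
  iso (there (there (here refl))) (there (there (here refl))) = ge (ℕₚ.n≮n a) refl

No321⇒¬Contains : ∀ {w} → No321 w → ¬ Contains w (3 ∷ 2 ∷ 1 ∷ [])
No321⇒¬Contains no321 (c ∷ b ∷ a ∷ [] , τ , iso) =
  no321 τ (<ᵇ-reflects {b} {2} {c} {3} (proj₂ (orderIso⁻ (c ∷ b ∷ a ∷ []) (3 ∷ 2 ∷ 1 ∷ []) iso) (there (here refl)) (here refl)) ℕₚ.≤-refl)
          (<ᵇ-reflects {a} {1} {b} {2} (proj₂ (orderIso⁻ (c ∷ b ∷ a ∷ []) (3 ∷ 2 ∷ 1 ∷ []) iso) (there (there (here refl))) (there (here refl))) ℕₚ.≤-refl)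
No321⇒¬Contains no321 (_ ∷ _ ∷ _ ∷ _ ∷ _ , _ , iso) = iso

-- Occurrences of the second pattern

∈-high : ∀ (Ts : List ℕ) {y t Bs x} → x ∈ t ∷ Ts → x ∈ Ts ++ y ∷ t ∷ Bs
∈-high Ts (here refl) = ∈-++⁺ʳ Ts (there (here refl))
∈-high Ts (there x∈)  = ∈-++⁺ˡ x∈

∈-low : ∀ (Ts : List ℕ) {y t Bs x} → x ∈ y ∷ Bs → x ∈ Ts ++ y ∷ t ∷ Bs
∈-low Ts (here refl) = ∈-++⁺ʳ Ts (here refl)
∈-low Ts (there x∈)  = ∈-++⁺ʳ Ts (there (there x∈))

AllPairs-⊆ : ∀ {R : ℕ → ℕ → Set} xs → (∀ {x y} → x ∷ y ∷ [] ⊆ xs → R x y) → AllPairs R xs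
AllPairs-⊆ []       h = []
AllPairs-⊆ (x ∷ xs) h = All.tabulate (λ y∈ → h (refl ∷ from∈ y∈)) ∷ AllPairs-⊆ xs (λ τ → h (x ∷ʳ τ))

Unique⇒≢ : ∀ {x y : ℕ} {w} → Unique w → x ∷ y ∷ [] ⊆ w → x ≢ y
Unique⇒≢ w! τ with (x≢y ∷ []) ∷ _ ← AllPairs-resp-⊆ τ w! = x≢y

≮∧≢⇒< : ∀ {x y} → ¬ y < x → x ≢ y → x < y
≮∧≢⇒< y≮x x≢y = ℕₚ.≤∧≢⇒< (ℕₚ.≮⇒≥ y≮x) x≢y

-- In a 321-avoiding word, the entries Ts ++ y ∷ t ∷ Bs are order isomorphic to
-- (d+1,…,k-1,1,k,2,…,d) as soon as every entry of t ∷ Ts exceeds every entry of y ∷ Bs.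
Cross : List ℕ → ℕ → ℕ → List ℕ → Set
Cross Ts y t Bs = ∀ {x e} → x ∈ t ∷ Ts → e ∈ y ∷ Bs → e < x

record Occ (α β : ℕ) (w : List ℕ) : Set where
  constructor occ
  field
    {Ts}  : List ℕ
    {y t} : ℕ
    {Bs}  : List ℕ
    sub   : Ts ++ y ∷ t ∷ Bs ⊆ w
    |Ts|  : length Ts ≡ α
    |Bs|  : length Bs ≡ β
    cross : Cross Ts y t Bs

module Pattern (T₀ : List ℕ) (y₀ t₀ : ℕ) (B₀ : List ℕ) (cross₀ : Cross T₀ y₀ t₀ B₀) where

  τ₀ = T₀ ++ y₀ ∷ t₀ ∷ B₀
  α = length T₀
  β = length B₀

  split-length : ∀ (T s : List ℕ) → length s ≡ length (T ++ y₀ ∷ t₀ ∷ B₀) →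
    ∃[ Ts ] ∃[ y ] ∃[ t ] ∃[ Bs ] s ≡ Ts ++ y ∷ t ∷ Bs × length Ts ≡ length T × length Bs ≡ β
  split-length []       (y ∷ t ∷ Bs) len = [] , y , t , Bs , refl , refl , ℕₚ.suc-injective (ℕₚ.suc-injective len)
  split-length (_ ∷ T)  (x ∷ s)      len with split-length T s (ℕₚ.suc-injective len)
  ... | Ts , y , t , Bs , eq , p , q = x ∷ Ts , y , t , Bs , cong (x ∷_) eq , cong suc p , q

  zip-split : ∀ Ts {y t Bs} → length Ts ≡ α →
    zip (Ts ++ y ∷ t ∷ Bs) τ₀ ≡ zip Ts T₀ ++ (y , y₀) ∷ (t , t₀) ∷ zip Bs B₀
  zip-split Ts |Ts| = zip-++ Ts T₀ |Ts|

  -- Each letter is paired with a pattern letter of the same role, and the order isomorphism pulls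
  -- `cross₀` back along this pairing.
  Contains⇒Occ : ∀ {w} → Contains w τ₀ → Occ α β w
  Contains⇒Occ (s , s⊆w , iso) with len , h ← orderIso⁻ s τ₀ iso
    with Ts , y , t , Bs , refl , |Ts| , |Bs| ← split-length T₀ s len =
    occ s⊆w |Ts| |Bs| (λ x∈ e∈ → let x₀ , x₀∈ , p = top x∈ ; e₀ , e₀∈ , q = bottom e∈ in
      <ᵇ-reflects {_} {e₀} {_} {x₀} (h (in-zip q) (in-zip p)) (cross₀ x₀∈ e₀∈))
    where
    in-zip : ∀ {p} → p ∈ zip Ts T₀ ++ (y , y₀) ∷ (t , t₀) ∷ zip Bs B₀ → p ∈ zip (Ts ++ y ∷ t ∷ Bs) τ₀
    in-zip {p} = subst (p ∈_) (sym (zip-split Ts |Ts|))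
    top : ∀ {x} → x ∈ t ∷ Ts → ∃[ x₀ ] x₀ ∈ t₀ ∷ T₀ × (x , x₀) ∈ zip Ts T₀ ++ (y , y₀) ∷ (t , t₀) ∷ zip Bs B₀
    top (here refl) = t₀ , here refl , ∈-++⁺ʳ (zip Ts T₀) (there (here refl))
    top (there x∈) with x₀ , x₀∈ , p ← zip-∈ |Ts| x∈ = x₀ , there x₀∈ , ∈-++⁺ˡ p
    bottom : ∀ {e} → e ∈ y ∷ Bs → ∃[ e₀ ] e₀ ∈ y₀ ∷ B₀ × (e , e₀) ∈ zip Ts T₀ ++ (y , y₀) ∷ (t , t₀) ∷ zip Bs B₀
    bottom (here refl) = y₀ , here refl , ∈-++⁺ʳ (zip Ts T₀) (here refl)
    bottom (there e∈) with e₀ , e₀∈ , p ← zip-∈ |Bs| e∈ = e₀ , there e₀∈ , ∈-++⁺ʳ (zip Ts T₀) (there (there p))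

  -- `Cross` settles every comparison between the two groups. Within a group the letters must
  -- increase: a descent among the tops followed by some B, or a descent among the bottoms preceded
  -- by some T, is a 321.
  Occ⇒Contains : AllPairs _<_ (T₀ ++ t₀ ∷ []) → AllPairs _<_ (y₀ ∷ B₀) → 1 ≤ α → 1 ≤ β →
    ∀ {w} → No321 w → Unique w → Occ α β w → Contains w τ₀
  Occ⇒Contains incT₀ incB₀ 1≤α 1≤β {w} no321 w! (occ {[]} _ |Ts| _ _) = contradiction (subst (1 ≤_) (sym |Ts|) 1≤α) λ ()
  Occ⇒Contains incT₀ incB₀ 1≤α 1≤β {w} no321 w! (occ {_ ∷ _} {Bs = []} _ _ |Bs| _) = contradiction (subst (1 ≤_) (sym |Bs|) 1≤β) λ ()
  Occ⇒Contains incT₀ incB₀ 1≤α 1≤β {w} no321 w! (occ {Ts@(T ∷ Ts′)} {y} {t} {Bs@(B ∷ Bs′)} τ |Ts| |Bs| cross) =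
    s , τ , orderIso⁺ s τ₀ len iso
    where
    s = Ts ++ y ∷ t ∷ Bs
    len : length s ≡ length τ₀
    len = trans (Listₚ.length-++ Ts) (trans (cong₂ _+_ |Ts| (cong (suc ∘ suc) |Bs|)) (sym (Listₚ.length-++ T₀)))
    ∈-tops : ∀ {x} → x ∈ Ts ++ t ∷ [] → x ∈ t ∷ Ts
    ∈-tops x∈ with ∈-++⁻ Ts x∈
    ... | inj₁ p           = there p
    ... | inj₂ (here refl) = here refl
    incT : AllPairs _<_ (Ts ++ t ∷ [])
    incT = AllPairs-⊆ (Ts ++ t ∷ []) λ {x} {x′} σ → ≮∧≢⇒<
      (λ x′<x → no321 (⊆-trans (++-⊆ σ (refl {x = B} ∷ minimum _)) tops⊆w) x′<x (cross (∈-tops (lookup σ (there (here refl)))) (there (here refl))))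
      (Unique⇒≢ w! (⊆-trans σ (⊆-trans (++-⊆ʳ Bs ⊆-refl) tops⊆w)))
      where
      tops⊆w : (Ts ++ t ∷ []) ++ Bs ⊆ w
      tops⊆w = ⊆-trans (subst (_⊆ s) (sym (Listₚ.++-assoc Ts (t ∷ []) Bs)) (++-⊆ (⊆-refl {x = Ts}) (y ∷ʳ ⊆-refl))) τ
    incB : AllPairs _<_ (y ∷ Bs)
    incB = AllPairs-⊆ (y ∷ Bs) λ {e} {e′} σ → ≮∧≢⇒<
      (λ e′<e → no321 (⊆-trans (refl {x = T} ∷ σ) bottoms⊆w) (cross (there (here refl)) (lookup σ (here refl))) e′<e)
      (Unique⇒≢ w! (⊆-trans σ (⊆-trans (T ∷ʳ ⊆-refl) bottoms⊆w)))
      where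
      bottoms⊆w : T ∷ y ∷ Bs ⊆ w
      bottoms⊆w = ⊆-trans (refl ∷ ++-⊆ˡ Ts′ (refl ∷ (t ∷ʳ ⊆-refl))) τ
    classify : ∀ {p} → p ∈ zip s τ₀ → p ∈ zip (Ts ++ t ∷ []) (T₀ ++ t₀ ∷ []) ⊎ p ∈ zip (y ∷ Bs) (y₀ ∷ B₀)
    classify p∈ with ∈-++⁻ (zip Ts T₀) (subst (_ ∈_) (zip-split Ts |Ts|) p∈)
    ... | inj₁ q                     = inj₁ (subst (_ ∈_) (sym (zip-++ Ts T₀ |Ts|)) (∈-++⁺ˡ q))
    ... | inj₂ (here refl)           = inj₂ (here refl)
    ... | inj₂ (there (here refl))   = inj₁ (subst (_ ∈_) (sym (zip-++ Ts T₀ |Ts|)) (∈-++⁺ʳ (zip Ts T₀) (here refl)))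
    ... | inj₂ (there (there q))     = inj₂ (there q)
    ∈-tops₀ : ∀ {x} → x ∈ T₀ ++ t₀ ∷ [] → x ∈ t₀ ∷ T₀
    ∈-tops₀ x∈ with ∈-++⁻ T₀ x∈
    ... | inj₁ p           = there p
    ... | inj₂ (here refl) = here refl
    above : ∀ {a b c e} → (a , b) ∈ zip (Ts ++ t ∷ []) (T₀ ++ t₀ ∷ []) → (c , e) ∈ zip (y ∷ Bs) (y₀ ∷ B₀) → c < a × e < b
    above p q = cross (∈-tops (∈-zipˡ p)) (∈-zipˡ q) , cross₀ (∈-tops₀ (∈-zipʳ p)) (∈-zipʳ q)
    iso : ∀ {a b c e} → (a , b) ∈ zip s τ₀ → (c , e) ∈ zip s τ₀ → (a <ᵇ c) ≡ (b <ᵇ e)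
    iso p q with classify p | classify q
    ... | inj₁ p′ | inj₁ q′ = increasing-iso incT incT₀ p′ q′
    ... | inj₂ p′ | inj₂ q′ = increasing-iso incB incB₀ p′ q′
    ... | inj₁ p′ | inj₂ q′ with c<a , e<b ← above p′ q′ =
      trans (≮⇒<ᵇ≡false (ℕₚ.<-asym c<a)) (sym (≮⇒<ᵇ≡false (ℕₚ.<-asym e<b)))
    ... | inj₂ p′ | inj₁ q′ with c<a , e<b ← above q′ p′ = trans (<⇒<ᵇ≡true c<a) (sym (<⇒<ᵇ≡true e<b))

-- Restricted to the entries of the word because `pred` and `pinch v`, used later, each merge two
-- values of ℕ.
Mono : (ℕ → ℕ) → List ℕ → Set
Mono g w = ∀ {x y} → x ∈ w → y ∈ w → x < y → g x < g y

No321-map⁻ : ∀ {g w} → Mono g w → No321 (map g w) → No321 w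
No321-map⁻ {g} mono no321 τ b<c a<b = no321 (map-⊆ g τ)
  (mono (lookup τ (there (here refl))) (lookup τ (here refl)) b<c)
  (mono (lookup τ (there (there (here refl)))) (lookup τ (there (here refl))) a<b)

Occ-map⁺ : ∀ {α β g w} → Mono g w → Occ α β w → Occ α β (map g w)
Occ-map⁺ {g = g} {w} mono (occ {Ts} {y} {t} {Bs} τ |Ts| |Bs| cross) =
  occ (subst (_⊆ map g w) (Listₚ.map-++ g Ts (y ∷ t ∷ Bs)) (map-⊆ g τ))
    (trans (Listₚ.length-map g Ts) |Ts|) (trans (Listₚ.length-map g Bs) |Bs|)
    (λ x∈ e∈ → cross′ (∈-map⁻ g {xs = t ∷ Ts} x∈) (∈-map⁻ g {xs = y ∷ Bs} e∈))
  where
  cross′ : ∀ {x e} → (∃[ x′ ] x′ ∈ t ∷ Ts × x ≡ g x′) → (∃[ e′ ] e′ ∈ y ∷ Bs × e ≡ g e′) → e < x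
  cross′ (_ , x′∈ , refl) (_ , e′∈ , refl) =
    mono (lookup τ (∈-low Ts e′∈)) (lookup τ (∈-high Ts x′∈)) (cross x′∈ e′∈)

Occ-⊆ : ∀ {α β v w} → v ⊆ w → Occ α β v → Occ α β w
Occ-⊆ v⊆w (occ τ |Ts| |Bs| cross) = occ (⊆-trans τ v⊆w) |Ts| |Bs| cross

suc-mono : ∀ w → Mono suc w
suc-mono w _ _ = s≤s

map-pred-suc : ∀ w → map pred (map suc w) ≡ w
map-pred-suc w = trans (sym (Listₚ.map-∘ w)) (Listₚ.map-id w)

pred-mono : ∀ w → Mono pred (map suc w)
pred-mono w x∈ y∈ x<y with _ , _ , refl ← ∈-map⁻ suc x∈ | _ , _ , refl ← ∈-map⁻ suc y∈ = ℕₚ.≤-pred x<y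

No321-map-suc : ∀ w → No321 w → No321 (map suc w)
No321-map-suc w no321 = No321-map⁻ (pred-mono w) (subst No321 (sym (map-pred-suc w)) no321)

Occ-map-suc⁻ : ∀ {α β} w → Occ α β (map suc w) → Occ α β w
Occ-map-suc⁻ w o = subst (Occ _ _) (map-pred-suc w) (Occ-map⁺ (pred-mono w) o)

record Av (α β n : ℕ) (w : List ℕ) : Set where
  constructor av
  field
    len   : length w ≡ n
    bound : All (_< n) w
    uniq  : Unique w
    no321 : No321 w
    noOcc : ¬ Occ α β w

-- Inserting and deleting entries

⊆-remove : ∀ {z : ℕ} {s} xs {ys} → z ∉ s → s ⊆ xs ++ z ∷ ys → s ⊆ xs ++ ys
⊆-remove []       z∉s (_ ∷ʳ τ)   = τ
⊆-remove []       z∉s (refl ∷ τ) = contradiction (here refl) z∉s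
⊆-remove (x ∷ xs) z∉s (_ ∷ʳ τ)   = x ∷ʳ ⊆-remove xs z∉s τ
⊆-remove (x ∷ xs) z∉s (refl ∷ τ) = refl ∷ ⊆-remove xs (z∉s ∘ there) τ

-- The larger word has only one z, so the embedding must match the two copies and splits there.
⊆-split-at : ∀ {z : ℕ} Ts {r} xs {ys} → z ∉ xs → z ∉ ys → Ts ++ z ∷ r ⊆ xs ++ z ∷ ys → Ts ⊆ xs × r ⊆ ys
⊆-split-at []       []       z∉xs z∉ys (_ ∷ʳ τ)   = contradiction (lookup τ (here refl)) z∉ys
⊆-split-at []       []       z∉xs z∉ys (refl ∷ τ) = [] , τ
⊆-split-at (_ ∷ Ts) []       z∉xs z∉ys (_ ∷ʳ τ)   = contradiction (lookup τ (there (∈-++⁺ʳ Ts (here refl)))) z∉ys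
⊆-split-at (_ ∷ Ts) []       z∉xs z∉ys (refl ∷ τ) = contradiction (lookup τ (∈-++⁺ʳ Ts (here refl))) z∉ys
⊆-split-at []       (x ∷ xs) z∉xs z∉ys (_ ∷ʳ τ)
  with p , q ← ⊆-split-at [] xs (z∉xs ∘ there) z∉ys τ = x ∷ʳ p , q
⊆-split-at []       (x ∷ xs) z∉xs z∉ys (refl ∷ τ) = contradiction (here refl) z∉xs
⊆-split-at (T ∷ Ts) (x ∷ xs) z∉xs z∉ys (_ ∷ʳ τ)
  with p , q ← ⊆-split-at (T ∷ Ts) xs (z∉xs ∘ there) z∉ys τ = x ∷ʳ p , q
⊆-split-at (_ ∷ Ts) (x ∷ xs) z∉xs z∉ys (refl ∷ τ)
  with p , q ← ⊆-split-at Ts xs (z∉xs ∘ there) z∉ys τ = refl ∷ p , q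

0∉map-suc : ∀ w → 0 ∉ map suc w
0∉map-suc w 0∈ with ∈-map⁻ suc 0∈
... | _ , _ , ()

-- A permutation seen from its 0: `u` and `v` are the stretches around it, lowered by one so that
-- `u ++ v` is a permutation again.
ins : List ℕ → List ℕ → List ℕ
ins u v = map suc u ++ 0 ∷ map suc v

map-suc⊆ins : ∀ u v → map suc (u ++ v) ⊆ ins u v
map-suc⊆ins u v = subst (_⊆ ins u v) (sym (Listₚ.map-++ suc u v)) (++-⊆ (⊆-refl {x = map suc u}) (0 ∷ʳ ⊆-refl))

ins-remove : ∀ {s} u v → 0 ∉ s → s ⊆ ins u v → s ⊆ map suc (u ++ v)
ins-remove u v 0∉s τ = subst (_ ⊆_) (sym (Listₚ.map-++ suc u v)) (⊆-remove (map suc u) 0∉s τ)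

ins-split : ∀ Ts {r} u v → Ts ++ 0 ∷ r ⊆ ins u v → Ts ⊆ map suc u × r ⊆ map suc v
ins-split Ts u v = ⊆-split-at Ts (map suc u) (0∉map-suc u) (0∉map-suc v)

length-ins : ∀ u v → length (ins u v) ≡ suc (length (u ++ v))
length-ins u v = trans (Listₚ.length-++ (map suc u)) (trans (ℕₚ.+-suc _ _)
  (cong suc (trans (cong₂ _+_ (Listₚ.length-map suc u) (Listₚ.length-map suc v)) (sym (Listₚ.length-++ u)))))

-- The pigeonhole that excludes small tops: a top lies above the β+1 distinct letters y and B.
below-unique : ∀ {v} {w : List ℕ} → Unique w → (∀ {x} → x ∈ w → x < v) → length w ≤ v
below-unique {v} w! w<v = subst (_ ≤_) (Listₚ.length-upTo v) (length-⊆ w! (λ x∈ → ∈-upTo⁺ (w<v x∈)))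

map-suc⁻ : ∀ {w} → 0 ∉ w → ∃[ u ] w ≡ map suc u
map-suc⁻ {[]}        _   = [] , refl
map-suc⁻ {zero ∷ w}  0∉w = contradiction (here refl) 0∉w
map-suc⁻ {suc x ∷ w} 0∉w with u , refl ← map-suc⁻ (0∉w ∘ there) = x ∷ u , refl

-- The order embedding of ℕ that skips v; `pinch v` undoes it by closing the gap.
shift : ℕ → ℕ → ℕ
shift v x with x <? v
... | yes _ = x
... | no _  = suc x

pinch : ℕ → ℕ → ℕ
pinch v x with x <? v
... | yes _ = x
... | no _  = pred x

pinch-shift : ∀ v x → pinch v (shift v x) ≡ x
pinch-shift v x with x <? v
... | yes x<v with x <? v
...   | yes _   = refl
...   | no  x≮v = contradiction x<v x≮v
pinch-shift v x | no x≮v with suc x <? v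
...   | yes sx<v = contradiction (ℕₚ.<-trans (ℕₚ.n<1+n x) sx<v) x≮v
...   | no  _    = refl

shift-pinch : ∀ {v x} → v ≢ x → shift v (pinch v x) ≡ x
shift-pinch {v} {x} v≢x with x <? v
... | yes x<v with x <? v
...   | yes _   = refl
...   | no  x≮v = contradiction x<v x≮v
shift-pinch {v} {zero} v≢x | no x≮v = contradiction (ℕₚ.n≢0⇒n>0 v≢x) x≮v
shift-pinch {v} {suc x} v≢x | no x≮v with x <? v
...   | yes x<v = contradiction (ℕₚ.≤∧≢⇒< x<v (v≢x ∘ sym)) x≮v
...   | no  _   = refl

shift-≢ : ∀ v x → v ≢ shift v x
shift-≢ v x v≡ with x <? v
... | yes x<v = ℕₚ.<⇒≢ x<v (sym v≡)
... | no  x≮v = x≮v (ℕₚ.≤-reflexive (sym v≡))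

shift-mono : ∀ {v x y} → x < y → shift v x < shift v y
shift-mono {v} {x} {y} x<y with x <? v | y <? v
... | yes _   | yes _   = x<y
... | yes _   | no  _   = ℕₚ.m<n⇒m<1+n x<y
... | no  x≮v | yes y<v = contradiction (ℕₚ.<-trans x<y y<v) x≮v
... | no  _   | no  _   = s≤s x<y

pinch-mono : ∀ {v x y} → v ≢ x → v ≢ y → x < y → pinch v x < pinch v y
pinch-mono {v} {x} {y} v≢x v≢y x<y = ℕₚ.≰⇒> λ py≤px →
  ℕₚ.<⇒≱ x<y (subst₂ _≤_ (shift-pinch v≢y) (shift-pinch v≢x) (shift-mono-≤ py≤px))
  where
  shift-mono-≤ : ∀ {a b} → a ≤ b → shift v a ≤ shift v b
  shift-mono-≤ a≤b with ℕₚ.m≤n⇒m<n∨m≡n a≤b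
  ... | inj₁ a<b  = ℕₚ.<⇒≤ (shift-mono a<b)
  ... | inj₂ refl = ℕₚ.≤-refl

shift-≥ : ∀ {v x} → v ≤ x → shift v x ≡ suc x
shift-≥ {v} {x} v≤x with x <? v
... | yes x<v = contradiction v≤x (ℕₚ.<⇒≱ x<v)
... | no  _   = refl

pinch-≥ : ∀ {v x} → v < x → v ≤ pinch v x
pinch-≥ {v} {suc x} v<x with suc x <? v
... | yes x<v = contradiction v<x (ℕₚ.<-asym x<v)
... | no  _   = ℕₚ.≤-pred v<x

map-pinch-shift : ∀ v w → map (pinch v) (map (shift v) w) ≡ w
map-pinch-shift v w = trans (sym (Listₚ.map-∘ w)) (trans (Listₚ.map-cong (pinch-shift v) w) (Listₚ.map-id w))

map-shift-pinch : ∀ {v} w → All (v ≢_) w → map (shift v) (map (pinch v) w) ≡ w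
map-shift-pinch []      []          = refl
map-shift-pinch (x ∷ w) (v≢x ∷ v≢w) = cong₂ _∷_ (shift-pinch v≢x) (map-shift-pinch w v≢w)

shift-bound : ∀ {v n x} → v ≤ n → x < n → shift v x < suc n
shift-bound {v} {n} {x} v≤n x<n with x <? v
... | yes _ = ℕₚ.m<n⇒m<1+n x<n
... | no  _ = s≤s x<n

pinch-bound : ∀ {v n x} → v < suc n → x < suc n → v ≢ x → pinch v x < n
pinch-bound {v} {n} {x} v<sn x<sn v≢x with x <? v
... | yes x<v = ℕₚ.≤-trans x<v (ℕₚ.≤-pred v<sn)
pinch-bound {v} {n} {zero}  v<sn x<sn v≢x | no x≮v = contradiction (ℕₚ.n≢0⇒n>0 v≢x) x≮v
pinch-bound {v} {n} {suc x} v<sn x<sn v≢x | no x≮v = ℕₚ.≤-pred x<sn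

module Words (α β : ℕ) (1≤α : 1 ≤ α) (1≤β : 1 ≤ β) where

  open Av

  del-Av : ∀ {n} u v → Av α β (suc n) (ins u v) → Av α β n (u ++ v)
  del-Av {n} u v a = av
    (ℕₚ.suc-injective (trans (sym (length-ins u v)) (len a)))
    (All.map ℕₚ.≤-pred (Allₚ.map⁻ (All-resp-⊆ (map-suc⊆ins u v) (bound a))))
    (Uniqueₚ.map⁻ (AllPairs-resp-⊆ (map-suc⊆ins u v) (uniq a)))
    (No321-map⁻ (suc-mono (u ++ v)) (λ τ → no321 a (⊆-trans τ (map-suc⊆ins u v))))
    (noOcc a ∘ Occ-⊆ (map-suc⊆ins u v) ∘ Occ-map⁺ (suc-mono (u ++ v)))

  -- A descent before the 0 would make a 321 with it.
  ins-increasing : ∀ {n} u v → Av α β (suc n) (ins u v) → AllPairs _<_ u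
  ins-increasing u v a = AllPairs-⊆ u λ {x} {y} σ → ≮∧≢⇒<
    (λ y<x → no321 a (++-⊆ (map-⊆ suc σ) (refl {x = 0} ∷ minimum _)) (s≤s y<x) (s≤s z≤n))
    (λ x≡y → Unique⇒≢ (uniq a) (⊆-trans (map-⊆ suc σ) (++-⊆ʳ (0 ∷ map suc v) ⊆-refl)) (cong suc x≡y))

  -- In a 321-avoiding word 0 can only play the role of y in an occurrence.
  Safe : List ℕ → List ℕ → Set
  Safe u v = ∀ Ts t Bs → Ts ⊆ map suc u → t ∷ Bs ⊆ map suc v →
    length Ts ≡ α → length Bs ≡ β → Cross Ts 0 t Bs → ⊥

  -- The new 0 can only end a 321, which would need a descent in `u`; as y of an occurrence it is
  -- excluded by `Safe`. Anything without the 0 already lies in `u ++ v`.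
  ins-Av : ∀ {n} u v → Av α β n (u ++ v) → AllPairs _<_ u → Safe u v → Av α β (suc n) (ins u v)
  ins-Av {n} u v a inc safe = av (trans (length-ins u v) (cong suc (len a))) bound′ uniq′ no321′ noOcc′
    where
    bound′ : All (_< suc n) (ins u v)
    bound′ with p , q ← Allₚ.++⁻ u (bound a) =
      Allₚ.++⁺ (Allₚ.map⁺ (All.map s≤s p)) (s≤s z≤n ∷ Allₚ.map⁺ (All.map s≤s q))
    uniq′ : Unique (ins u v)
    uniq′ = AllPairs-⊆ (ins u v) go
      where
      go : ∀ {x y} → x ∷ y ∷ [] ⊆ ins u v → x ≢ y
      go {zero}  {zero}  τ _ = contradiction (lookup (proj₂ (ins-split [] u v τ)) (here refl)) (0∉map-suc v)
      go {suc x} {suc y} τ   = Unique⇒≢ (Uniqueₚ.map⁺ ℕₚ.suc-injective (uniq a))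
        (ins-remove u v (λ { (there (here ())) }) τ)
    no321′ : No321 (ins u v)
    no321′ {suc c} {suc b} {zero}  τ b<c _
      with (c<b ∷ []) ∷ _ ← AllPairs-resp-⊆ (proj₁ (ins-split (suc c ∷ suc b ∷ []) u v τ)) (AllPairsₚ.map⁺ {R = _<_} (AllPairs.map s≤s inc))
      = ℕₚ.<-asym b<c c<b
    no321′ {suc c} {suc b} {suc a′} τ = No321-map-suc (u ++ v) (no321 a)
      (ins-remove u v (λ { (there (there (here ()))) ; (there (there (there ()))) }) τ)
    noOcc′ : ¬ Occ α β (ins u v)
    noOcc′ (occ {Ts} {zero} {t} {Bs} τ |Ts| |Bs| cross)
      with p , q ← ins-split Ts u v τ = safe Ts t Bs p q |Ts| |Bs| cross
    noOcc′ (occ {[]} {suc y} τ |Ts| |Bs| cross) = contradiction (subst (1 ≤_) (sym |Ts|) 1≤α) λ ()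
    noOcc′ (occ {Ts@(T ∷ Ts′)} {suc y} {t} {Bs} τ |Ts| |Bs| cross) =
      noOcc a (Occ-map-suc⁻ (u ++ v) (occ (ins-remove u v 0∉ τ) |Ts| |Bs| cross))
      where
      pos : ∀ {x} → x ∈ t ∷ Ts → 0 ≢ x
      pos x∈ refl with () ← cross x∈ (here refl)
      0∉ : 0 ∉ Ts ++ suc y ∷ t ∷ Bs
      0∉ 0∈ with ∈-++⁻ Ts 0∈
      ... | inj₁ p                         = pos (there p) refl
      ... | inj₂ (there (here 0≡t))        = pos (here refl) 0≡t
      -- A 0 among the B would give the 321 formed by T, `suc y` and 0.
      ... | inj₂ (there (there 0∈Bs))      =
        no321′ (⊆-trans (refl {x = T} ∷ ++-⊆ˡ Ts′ (refl {x = suc y} ∷ (t ∷ʳ from∈ 0∈Bs))) τ) (cross (there (here refl)) (here refl)) (s≤s z≤n)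

  -- A missing value could be added to the entries, giving n+1 distinct numbers below n.
  full : ∀ {n w x} → Av α β n w → x < n → x ∈ w
  full {n} {w} {x} a x<n with x ∈? w
  ... | yes x∈ = x∈
  ... | no  x∉ = contradiction (below-unique (All.tabulate (λ { y∈ refl → x∉ y∈ }) ∷ uniq a) bounded)
    (ℕₚ.<⇒≱ (s≤s (ℕₚ.≤-reflexive (sym (len a)))))
    where
    bounded : ∀ {y} → y ∈ x ∷ w → y < n
    bounded (here refl) = x<n
    bounded (there y∈)  = All.lookup (bound a) y∈

  zero-position : ∀ {n w} → Av α β (suc n) w → ∃₂ λ u v → w ≡ ins u v
  zero-position a with us , vs , refl ← ∈-∃++ (full a (s≤s z≤n))
    with u , refl ← map-suc⁻ {us} (λ 0∈ → Unique⇒≢ (uniq a) (++-⊆ (from∈ 0∈) (refl {x = 0} ∷ minimum vs)) refl)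
       | v , refl ← map-suc⁻ {vs} (λ 0∈ → Unique⇒≢ (uniq a) (++-⊆ˡ us (refl {x = 0} ∷ from∈ 0∈)) refl)
    = u , v , refl

  tail-Av : ∀ {n v w} → Av α β (suc n) (v ∷ w) → Av α β n (map (pinch v) w)
  tail-Av {n} {v} {w} a with v≢w ∷ w! ← uniq a | v<sn ∷ w<sn ← bound a = av
    (trans (Listₚ.length-map (pinch v) w) (ℕₚ.suc-injective (len a)))
    (Allₚ.map⁺ (All.map (λ (v≢x , x<sn) → pinch-bound v<sn x<sn v≢x) (All.zip (v≢w , w<sn))))
    (Uniqueₚ.map⁻ {f = shift v} (subst Unique (sym w≡) w!))
    (No321-map⁻ {shift v} (λ _ _ → shift-mono) (subst No321 (sym w≡) λ τ → no321 a (v ∷ʳ τ)))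
    (λ o → noOcc a (Occ-⊆ (v ∷ʳ ⊆-refl) (subst (Occ α β) w≡ (Occ-map⁺ {g = shift v} (λ _ _ → shift-mono) o))))
    where
    w≡ = map-shift-pinch w v≢w

  -- Because v ≤ x, the shifted x exceeds the new head and could replace it at the start of any 321.
  -- Because v ≤ β, the β+1 distinct letters y and B do not fit below v, so the new head is no T.
  cons-Av : ∀ {n v x w} → v ≤ x → v ≤ β → Av α β n (x ∷ w) → Av α β (suc n) (v ∷ map (shift v) (x ∷ w))
  cons-Av {n} {v} {x} {w} v≤x v≤β a = av
    (cong suc (trans (Listₚ.length-map (shift v) (x ∷ w)) (len a)))
    (ℕₚ.m<n⇒m<1+n v<n ∷ Allₚ.map⁺ (All.map (shift-bound (ℕₚ.<⇒≤ v<n)) (bound a)))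
    uniq′
    no321′ noOcc′
    where
    z = map (shift v) (x ∷ w)
    v<n : v < n
    v<n = ℕₚ.≤-<-trans v≤x (All.head (bound a))
    v≢z : All (v ≢_) z
    v≢z = Allₚ.map⁺ {f = shift v} (All.universal (shift-≢ v) (x ∷ w))
    uniq′ : Unique (v ∷ z)
    uniq′ = v≢z ∷ Uniqueₚ.map⁺ (λ {p} {q} eq → trans (sym (pinch-shift v p)) (trans (cong (pinch v) eq) (pinch-shift v q))) (uniq a)
    mono : Mono (pinch v) z
    mono p q = pinch-mono (All.lookup v≢z p) (All.lookup v≢z q)
    no321-z : No321 z
    no321-z = No321-map⁻ {pinch v} mono (subst No321 (sym (map-pinch-shift v (x ∷ w))) (no321 a))
    v<shift : v < shift v x
    v<shift = subst (v <_) (sym (shift-≥ v≤x)) (s≤s v≤x)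
    no321′ : No321 (v ∷ z)
    no321′ (_ ∷ʳ τ)          = no321-z τ
    no321′ (refl ∷ (_ ∷ʳ τ)) b<v a<b = no321-z (refl {x = shift v x} ∷ τ) (ℕₚ.<-trans b<v v<shift) a<b
    no321′ (refl ∷ (refl ∷ τ)) b<v a<b = ℕₚ.<-asym b<v v<shift
    noOcc′ : ¬ Occ α β (v ∷ z)
    noOcc′ (occ {[]} _ |Ts| _ _) = contradiction (subst (1 ≤_) (sym |Ts|) 1≤α) λ ()
    noOcc′ (occ {T ∷ Ts} (_ ∷ʳ τ) |Ts| |Bs| cross) =
      noOcc a (subst (Occ α β) (map-pinch-shift v (x ∷ w)) (Occ-map⁺ {g = pinch v} mono (occ τ |Ts| |Bs| cross)))
    noOcc′ (occ {T ∷ Ts} {y} {t} {Bs} (refl ∷ τ) |Ts| |Bs| cross) =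
      contradiction (below-unique (AllPairs-resp-⊆ (⊆-trans (++-⊆ˡ Ts (refl {x = y} ∷ (t ∷ʳ ⊆-refl))) (v ∷ʳ τ)) uniq′) (cross (there (here refl))))
        (ℕₚ.<⇒≱ (s≤s (ℕₚ.≤-trans v≤β (ℕₚ.≤-reflexive (sym |Bs|)))))

-- Bijections between classes of avoiders

Pre : ℕ → ℕ → List ℕ → Set
Pre zero    v w       = ⊤
Pre (suc i) v []      = ⊥
Pre (suc i) v (x ∷ w) = v ≤ x × Pre i v w

-- The i entries after the head are to exceed it. These are the words that `Pre (suc i) v` loses
-- when v is raised, as soon as its prefix is known to increase.
HeadPre : ℕ → ℕ → List ℕ → Set
HeadPre i v []      = ⊥
HeadPre i v (x ∷ w) = x ≡ v × Pre i (suc v) w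

pre? : ∀ i v → Decidable (Pre i v)
pre? zero    v w       = yes tt
pre? (suc i) v []      = no λ ()
pre? (suc i) v (x ∷ w) = v ≤? x ×-dec pre? i v w

headPre? : ∀ i v → Decidable (HeadPre i v)
headPre? i v []      = no λ ()
headPre? i v (x ∷ w) = x ≟ v ×-dec pre? i (suc v) w

Pre-≤ : ∀ i {v w} → Pre i v w → i ≤ length w
Pre-≤ zero    _                   = z≤n
Pre-≤ (suc i) {w = _ ∷ _} (_ , p) = s≤s (Pre-≤ i p)

-- The threshold is positive, so the prefix ends before the 0 and anything may follow `u`. Taking
-- `y` empty bounds i by the length of `u`.
Pre-ins⁻ : ∀ i {v} u {z} y → Pre i (suc v) (map suc u ++ 0 ∷ z) → Pre i v (u ++ y)
Pre-ins⁻ zero    _       y _              = tt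
Pre-ins⁻ (suc i) (x ∷ u) y (s≤s v≤x , p)  = v≤x , Pre-ins⁻ i u y p

Pre-ins⁺ : ∀ i {v} u {z} → Pre i v u → Pre i (suc v) (map suc u ++ z)
Pre-ins⁺ zero    _       _         = tt
Pre-ins⁺ (suc i) (x ∷ u) (v≤x , p) = s≤s v≤x , Pre-ins⁺ i u p

Pre-zero : ∀ i {v} u {y} → 1 ≤ v → Pre i v (u ++ 0 ∷ y) → Pre i v u
Pre-zero zero    _       _   _         = tt
Pre-zero (suc i) []      1≤v (v≤0 , _) = contradiction v≤0 (ℕₚ.<⇒≱ 1≤v)
Pre-zero (suc i) (x ∷ u) 1≤v (v≤x , p) = v≤x , Pre-zero i u 1≤v p

Pre-++ : ∀ i {v} u {y} → i ≤ length u → Pre i v (u ++ y) → Pre i v u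
Pre-++ zero    _       _         _         = tt
Pre-++ (suc i) (x ∷ u) (s≤s i≤u) (v≤x , p) = v≤x , Pre-++ i u i≤u p

Pre-All : ∀ i {v w} → All (v ≤_) w → i ≤ length w → Pre i v w
Pre-All zero    _           _         = tt
Pre-All (suc i) (v≤x ∷ v≤w) (s≤s i≤w) = v≤x , Pre-All i v≤w i≤w

Pre-map : ∀ i {v v′} f {w} → (∀ {x} → v ≤ x → v′ ≤ f x) → Pre i v w → Pre i v′ (map f w)
Pre-map zero    f             _ _         = tt
Pre-map (suc i) f {x ∷ w} h (v≤x , p) = h v≤x , Pre-map i f h p

increasing-All : ∀ {v x u} → AllPairs _<_ (x ∷ u) → v ≤ x → All (v ≤_) (x ∷ u)
increasing-All (x<u ∷ _) v≤x = v≤x ∷ All.map (λ x<y → ℕₚ.≤-trans v≤x (ℕₚ.<⇒≤ x<y)) x<u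

drop-zero : List ℕ → List ℕ
drop-zero []          = []
drop-zero (zero ∷ w)  = drop-zero w
drop-zero (suc x ∷ w) = x ∷ drop-zero w

drop-zero-ins : ∀ u v → drop-zero (ins u v) ≡ u ++ v
drop-zero-ins []      []      = refl
drop-zero-ins []      (y ∷ v) = cong (y ∷_) (drop-zero-ins [] v)
drop-zero-ins (x ∷ u) v       = cong (x ∷_) (drop-zero-ins u v)

insert-zero : ℕ → List ℕ → List ℕ
insert-zero zero    w       = 0 ∷ map suc w
insert-zero (suc i) []      = 0 ∷ []
insert-zero (suc i) (x ∷ w) = suc x ∷ insert-zero i w

insert-zero-ins : ∀ u v → insert-zero (length u) (u ++ v) ≡ ins u v
insert-zero-ins []      v = refl
insert-zero-ins (x ∷ u) v = cong (suc x ∷_) (insert-zero-ins u v)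

-- All entries are raised and a new 0 is put directly before the old one, now 1.
double-zero : List ℕ → List ℕ
double-zero []          = []
double-zero (zero ∷ w)  = ins [] (0 ∷ w)
double-zero (suc x ∷ w) = suc (suc x) ∷ double-zero w

double-zero-ins : ∀ u v → 0 ∉ u → double-zero (u ++ 0 ∷ v) ≡ ins u (0 ∷ v)
double-zero-ins []          v 0∉u = refl
double-zero-ins (zero ∷ u)  v 0∉u = contradiction (here refl) 0∉u
double-zero-ins (suc x ∷ u) v 0∉u = cong (suc (suc x) ∷_) (double-zero-ins u v (0∉u ∘ there))

T-does : ∀ {P : Set} (P? : Dec P) → T (does P?) → P
T-does (yes p) _ = p

does-T : ∀ {P : Set} (P? : Dec P) → P → T (does P?)
does-T (yes _) _ = _
does-T (no ¬p) p = ⊥-elim (¬p p)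

countᵇ-cong : ∀ {p q} ws → (∀ w → p w ≡ q w) → countᵇ p ws ≡ countᵇ q ws
countᵇ-cong         []       _   = refl
countᵇ-cong {p} {q} (w ∷ ws) p≡q with p w | q w | p≡q w
... | true  | _ | refl = cong suc (countᵇ-cong ws p≡q)
... | false | _ | refl = countᵇ-cong ws p≡q

-- Counting avoiders by conditions on a prefix

module Counting (α β : ℕ) (1≤α : 1 ≤ α) (1≤β : 1 ≤ β) (τ : List ℕ)
  (Contains⇒Occ : ∀ {w} → Contains w τ → Occ α β w)
  (Occ⇒Contains : ∀ {w} → No321 w → Unique w → Occ α β w → Contains w τ)
  where

  open Words α β 1≤α 1≤β
  open Av

  -- Spelled as the predicate inside `avoidCount`, so that `total` is the count of the theorem by
  -- definition.
  avᵇ : ℕ → List ℕ → Bool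
  avᵇ n w = isPerm n w ∧ all (avoids w) ((3 ∷ 2 ∷ 1 ∷ []) ∷ τ ∷ [])

  avᵇ⇒Av : ∀ {n w} → w ∈ words n n → T (avᵇ n w) → Av α β n w
  avᵇ⇒Av {n} {w} w∈ h with d , h₁ ← Equivalence.to (T-∧ {distinct w}) h
    with a₁ , h₂ ← Equivalence.to (T-∧ {avoids w (3 ∷ 2 ∷ 1 ∷ [])}) h₁
    with a₂ , _ ← Equivalence.to (T-∧ {avoids w τ}) h₂
    with l , b ← ∈-words⁻ n n w∈ = av l b w! avoids321 (λ o → avoids⁻ w τ a₂ (Occ⇒Contains avoids321 w! o))
    where
    w! = distinct⇒Unique w d
    avoids321 : No321 w
    avoids321 σ b<c a<b = avoids⁻ w _ a₁ (321⇒Contains σ b<c a<b)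

  Av⇒avᵇ : ∀ {n w} → Av α β n w → w ∈ words n n × T (avᵇ n w)
  Av⇒avᵇ {n} {w} a = ∈-words⁺ n n (len a) (bound a) ,
    Equivalence.from (T-∧ {distinct w}) (Unique⇒distinct w (uniq a) ,
    Equivalence.from (T-∧ {avoids w (3 ∷ 2 ∷ 1 ∷ [])}) (avoids⁺ w _ (No321⇒¬Contains (no321 a)) ,
    Equivalence.from (T-∧ {avoids w τ}) (avoids⁺ w τ (noOcc a ∘ Contains⇒Occ) , _)))

  selectᵇ : ∀ {P : List ℕ → Set} → Decidable P → ℕ → List ℕ → Bool
  selectᵇ P? n w = avᵇ n w ∧ does (P? w)

  # : ∀ {P : List ℕ → Set} → Decidable P → ℕ → ℕ
  # P? n = countᵇ (selectᵇ P? n) (words n n)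

  select⁻ : ∀ {P} (P? : Decidable P) {n w} → w ∈ words n n → T (selectᵇ P? n w) → Av α β n w × P w
  select⁻ P? {n} {w} w∈ h with a , p ← Equivalence.to (T-∧ {avᵇ n w}) h = avᵇ⇒Av w∈ a , T-does (P? w) p

  select⁺ : ∀ {P} (P? : Decidable P) {n w} → Av α β n w → P w → T (selectᵇ P? n w)
  select⁺ P? {n} {w} a p = Equivalence.from (T-∧ {avᵇ n w}) (proj₂ (Av⇒avᵇ a) , does-T (P? w) p)

  #-≤ : ∀ {P Q} (P? : Decidable P) (Q? : Decidable Q) n m (f g : List ℕ → List ℕ) →
    (∀ {w} → Av α β n w → P w → (Av α β m (f w) × Q (f w)) × g (f w) ≡ w) → # P? n ≤ # Q? m
  #-≤ P? Q? n m f g h = countᵇ-≤ (selectᵇ P? n) (selectᵇ Q? m) (words-unique n n) f g λ w∈ sel →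
    let a , p = select⁻ P? w∈ sel ; (a′ , q) , gf = h a p in (proj₁ (Av⇒avᵇ a′) , select⁺ Q? a′ q) , gf

  #-bijection : ∀ {P Q} (P? : Decidable P) (Q? : Decidable Q) n m (f g : List ℕ → List ℕ) →
    (∀ {w} → Av α β n w → P w → (Av α β m (f w) × Q (f w)) × g (f w) ≡ w) →
    (∀ {w} → Av α β m w → Q w → (Av α β n (g w) × P (g w)) × f (g w) ≡ w) → # P? n ≡ # Q? m
  #-bijection P? Q? n m f g h₁ h₂ = ℕₚ.≤-antisym (#-≤ P? Q? n m f g h₁) (#-≤ Q? P? m n g f h₂)

  #-cong : ∀ {P Q} (P? : Decidable P) (Q? : Decidable Q) n →
    (∀ {w} → Av α β n w → P w → Q w) → (∀ {w} → Av α β n w → Q w → P w) → # P? n ≡ # Q? n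
  #-cong P? Q? n h₁ h₂ = #-bijection P? Q? n n (λ w → w) (λ w → w)
    (λ a p → (a , h₁ a p) , refl) (λ a q → (a , h₂ a q) , refl)

  #-split : ∀ {P Q R} (P? : Decidable P) (Q? : Decidable Q) (R? : Decidable R) n →
    (∀ {w} → Av α β n w → P w → Q w ⊎ R w) → (∀ {w} → Q w → P w) → (∀ {w} → R w → P w) → (∀ {w} → Q w → R w → ⊥) →
    # P? n ≡ # Q? n + # R? n
  #-split P? Q? R? n cover q⇒p r⇒p disjoint = countᵇ-split (selectᵇ P? n) (selectᵇ Q? n) (selectᵇ R? n) (words n n) λ w∈ →
    (λ sel → let a , p = select⁻ P? {n} w∈ sel in [ inj₁ ∘ select⁺ Q? {n} a , inj₂ ∘ select⁺ R? {n} a ]′ (cover a p)) ,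
    (λ sel → let a , q = select⁻ Q? {n} w∈ sel in select⁺ P? {n} a (q⇒p q)) ,
    (λ sel → let a , r = select⁻ R? {n} w∈ sel in select⁺ P? {n} a (r⇒p r)) ,
    (λ (s₁ , s₂) → disjoint (proj₂ (select⁻ Q? {n} w∈ s₁)) (proj₂ (select⁻ R? {n} w∈ s₂)))

  #-difference : ∀ {P Q} (P? : Decidable P) (Q? : Decidable Q) n → (∀ {w} → Q w → P w) →
    # P? n ≡ # Q? n + # (λ w → P? w ×-dec ¬? (Q? w)) n
  #-difference P? Q? n q⇒p = #-split P? Q? (λ w → P? w ×-dec ¬? (Q? w)) n
    (λ {w} _ p → dec (Q? w) p) q⇒p proj₁ (λ q (_ , ¬q) → ¬q q)
    where
    dec : ∀ {P Q : Set} → Dec Q → P → Q ⊎ (P × ¬ Q)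
    dec (yes q) p = inj₁ q
    dec (no ¬q) p = inj₂ (p , ¬q)

  -- The common frame for deleting 0. Deletion forgets the position of the 0, so `g` has to recover
  -- it from `Q`; an increasing `u` and `Safe` are what reinsertion requires.
  zero-bijection : ∀ {P Q} (P? : Decidable P) (Q? : Decidable Q) (g : List ℕ → List ℕ) n →
    (∀ u v → Av α β (suc n) (ins u v) → P (ins u v) → Q (u ++ v) × g (u ++ v) ≡ ins u v) →
    (∀ {w} → Av α β n w → Q w → ∃₂ λ u v → w ≡ u ++ v × g w ≡ ins u v × AllPairs _<_ u × Safe u v × P (ins u v)) →
    # P? (suc n) ≡ # Q? n
  zero-bijection {P} {Q} P? Q? g n fwd bwd = #-bijection P? Q? (suc n) n drop-zero g fwd′ bwd′
    where
    fwd′ : ∀ {w} → Av α β (suc n) w → P w → (Av α β n (drop-zero w) × Q (drop-zero w)) × g (drop-zero w) ≡ w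
    fwd′ a p with u , v , refl ← zero-position a rewrite drop-zero-ins u v
      with q , eq ← fwd u v a p = (del-Av u v a , q) , eq
    bwd′ : ∀ {w} → Av α β n w → Q w → (Av α β (suc n) (g w) × P (g w)) × drop-zero (g w) ≡ w
    bwd′ a q with u , v , refl , eq , inc , safe , p ← bwd a q rewrite eq =
      (ins-Av u v a inc safe , p) , drop-zero-ins u v

  -- A positive threshold places the prefix before the 0, where a 321-avoider increases.
  prefix-increasing : ∀ {n w} i {v} → 1 ≤ v → 1 ≤ i → Av α β n w → Pre i v w → AllPairs _<_ (take i w)
  prefix-increasing {zero} {[]}    (suc i) _   _   _ ()
  prefix-increasing {zero} {_ ∷ _} _       _   _   a _ with () ← len a
  prefix-increasing {suc n} i 1≤v _ a p with u , z , refl ← zero-position a =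
    subst (AllPairs _<_) (sym (take-++ i (map suc u) (Pre-≤ i (Pre-zero i (map suc u) 1≤v p))))
      (AllPairsₚ.take⁺ i (AllPairsₚ.map⁺ (AllPairs.map s≤s (ins-increasing u z a))))
    where
    take-++ : ∀ i (xs : List ℕ) {ys} → i ≤ length xs → take i (xs ++ ys) ≡ take i xs
    take-++ zero    xs       _         = refl
    take-++ (suc i) (x ∷ xs) (s≤s i≤n) = cong (x ∷_) (take-++ i xs i≤n)

  -- For v ≥ 1 the prefix precedes the 0 and increases, so its least entry is the head: raising the
  -- threshold loses exactly the words with head v. For i = 0 the prefix is the head alone.
  #-head-min : ∀ i v n → i ≡ 0 ⊎ 1 ≤ v →
    # (pre? (suc i) v) n ≡ # (pre? (suc i) (suc v)) n + # (headPre? i v) n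
  #-head-min i v n side = #-split (pre? (suc i) v) (pre? (suc i) (suc v)) (headPre? i v) n
    (λ {w} a p → cover n w a p side)
    (λ {w} → weaken w)
    (λ {w} → weaken′ w)
    (λ {w} → disjoint w)
    where
    pre-weaken : ∀ i w → Pre i (suc v) w → Pre i v w
    pre-weaken zero    _       _         = tt
    pre-weaken (suc i) (x ∷ w) (v<x , p) = ℕₚ.<⇒≤ v<x , pre-weaken i w p
    weaken : ∀ w → Pre (suc i) (suc v) w → Pre (suc i) v w
    weaken = pre-weaken (suc i)
    weaken′ : ∀ w → HeadPre i v w → Pre (suc i) v w
    weaken′ (x ∷ w) (refl , p) = ℕₚ.≤-refl , pre-weaken i w p
    disjoint : ∀ w → Pre (suc i) (suc v) w → HeadPre i v w → ⊥
    disjoint (x ∷ w) (v<x , _) (refl , _) = ℕₚ.n≮n v v<x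
    cover : ∀ n w → Av α β n w → Pre (suc i) v w → i ≡ 0 ⊎ 1 ≤ v → Pre (suc i) (suc v) w ⊎ HeadPre i v w
    cover n (x ∷ w) a (v≤x , p) (inj₁ refl) with ℕₚ.m≤n⇒m<n∨m≡n v≤x
    ... | inj₁ v<x  = inj₁ (v<x , tt)
    ... | inj₂ refl = inj₂ (refl , tt)
    cover zero (x ∷ w) a _ (inj₂ _) with () ← len a
    cover (suc n) w a p (inj₂ (s≤s z≤n)) with u , z , refl ← zero-position a = go u (ins-increasing u z a) p
      where
      go : ∀ u → AllPairs _<_ u → Pre (suc i) v (ins u z) → Pre (suc i) (suc v) (ins u z) ⊎ HeadPre i v (ins u z)
      go u inc p with Pre-≤ (suc i) (subst (Pre (suc i) _) (Listₚ.++-identityʳ u) (Pre-ins⁻ (suc i) u [] p))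
      go (x ∷ u) (x<u ∷ inc) (s≤s v≤x , p) | s≤s i≤u with ℕₚ.m≤n⇒m<n∨m≡n v≤x
      ... | inj₁ v<x  = inj₁ (Pre-ins⁺ (suc i) (x ∷ u) (Pre-All (suc i) (increasing-All (x<u ∷ inc) v<x) (s≤s i≤u)))
      ... | inj₂ refl = inj₂ (refl , Pre-ins⁺ i u (Pre-All i x<u i≤u))

  -- With i ≥ 1 the entry after the head exceeds it, and v ≤ β, as `cons-Av` demands for the way
  -- back.
  #-remove-head : ∀ i v n → 1 ≤ i → v ≤ β → # (headPre? i v) (suc n) ≡ # (pre? i v) n
  #-remove-head (suc i) v n _ v≤β =
    #-bijection (headPre? (suc i) v) (pre? (suc i) v) (suc n) n tail (λ w → v ∷ map (shift v) w) fwd bwd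
    where
    tail : List ℕ → List ℕ
    tail []      = []
    tail (x ∷ w) = map (pinch v) w
    fwd : ∀ {w} → Av α β (suc n) w → HeadPre (suc i) v w →
      (Av α β n (tail w) × Pre (suc i) v (tail w)) × v ∷ map (shift v) (tail w) ≡ w
    fwd {x ∷ w} a (refl , p) with x≢w ∷ _ ← uniq a =
      (tail-Av a , Pre-map (suc i) (pinch v) pinch-≥ p) , cong (v ∷_) (map-shift-pinch w x≢w)
    bwd : ∀ {w} → Av α β n w → Pre (suc i) v w →
      (Av α β (suc n) (v ∷ map (shift v) w) × HeadPre (suc i) v (v ∷ map (shift v) w)) × map (pinch v) (map (shift v) w) ≡ w
    bwd {x ∷ w} a p@(v≤x , _) =
      (cons-Av v≤x v≤β a , refl , Pre-map (suc i) (shift v) (λ v≤y → subst (v <_) (sym (shift-≥ v≤y)) (s≤s v≤y)) p) ,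
      map-pinch-shift v (x ∷ w)

  short-Safe : ∀ u v → length u < α → Safe u v
  short-Safe u v u<α Ts t Bs p q |Ts| |Bs| cross = ℕₚ.<⇒≱ u<α
    (subst₂ _≤_ |Ts| (Listₚ.length-map suc u) (length-mono-≤ p))

  -- As α ≥ 1, the only possible T is `suc x`, but 0 and the β letters B would need β+1 values below
  -- `suc x` ≤ β.
  singleton-Safe : ∀ x v {n} → Av α β n (x ∷ v) → x < β → Safe (x ∷ []) v
  singleton-Safe x v a x<β Ts t Bs p q |Ts| |Bs| cross = ℕₚ.<⇒≱ x<β (ℕₚ.≤-pred (subst (λ l → suc l ≤ suc x) |Bs|
    (below-unique (All.tabulate (λ {y} y∈ 0≡y → 0∉map-suc v (subst (_∈ map suc v) (sym 0≡y) (lookup q (there y∈)))) ∷ Bs!)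
      (cross x∈))))
    where
    x∈ : suc x ∈ t ∷ Ts
    x∈ = there (sole Ts p |Ts|)
      where
      sole : ∀ Ts → Ts ⊆ suc x ∷ [] → length Ts ≡ α → suc x ∈ Ts
      sole []       _          |Ts| = contradiction (subst (1 ≤_) (sym |Ts|) 1≤α) λ ()
      sole (_ ∷ _)  (refl ∷ _) _    = here refl
    Bs! : Unique Bs
    Bs! with _ ∷ v! ← uniq a = AllPairs-resp-⊆ (⊆-trans (t ∷ʳ ⊆-refl) q) (Uniqueₚ.map⁺ ℕₚ.suc-injective v!)

  -- Entries before the 0 increase, so a prefix with head ≥ v+1 can only be cut short by the 0: the
  -- words lost have it right after the first i entries. Deleting it lowers the threshold to v, and
  -- i < α makes reinsertion safe.
  #-zero-at : ∀ i v n → 1 ≤ v → 1 ≤ i → i < α →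
    # (pre? i (suc v)) (suc n) ≡ # (pre? (suc i) (suc v)) (suc n) + # (pre? i v) n
  #-zero-at i v n 1≤v 1≤i i<α = trans
    (#-difference (pre? i (suc v)) (pre? (suc i) (suc v)) (suc n) (λ {w} → shorten i w))
    (cong (_+_ (# (pre? (suc i) (suc v)) (suc n)))
      (zero-bijection (λ w → pre? i (suc v) w ×-dec ¬? (pre? (suc i) (suc v) w)) (pre? i v) (insert-zero i) n fwd bwd))
    where
    shorten : ∀ i {v} w → Pre (suc i) v w → Pre i v w
    shorten zero    _       _         = tt
    shorten (suc i) (x ∷ w) (v≤x , p) = v≤x , shorten i w p
    at-zero : ∀ i u z → 1 ≤ i → AllPairs _<_ u → Pre i (suc v) (ins u z) → ¬ Pre (suc i) (suc v) (ins u z) → length u ≡ i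
    at-zero i u z 1≤i inc p ¬p
      with i≤u ← Pre-≤ i (subst (Pre i v) (Listₚ.++-identityʳ u) (Pre-ins⁻ i u [] p)) with ℕₚ.m≤n⇒m<n∨m≡n i≤u
    ... | inj₂ i≡u = sym i≡u
    at-zero (suc i) (x ∷ u) z _ inc (s≤s v≤x , _) ¬p | inj₁ i<u =
      contradiction (Pre-ins⁺ (suc (suc i)) (x ∷ u) (Pre-All (suc (suc i)) (increasing-All inc v≤x) i<u)) ¬p
    fwd : ∀ u z → Av α β (suc n) (ins u z) → Pre i (suc v) (ins u z) × ¬ Pre (suc i) (suc v) (ins u z) →
      Pre i v (u ++ z) × insert-zero i (u ++ z) ≡ ins u z
    fwd u z a (p , ¬p) with refl ← at-zero i u z 1≤i (ins-increasing u z a) p ¬p = Pre-ins⁻ i u z p , insert-zero-ins u z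
    bwd : ∀ {w} → Av α β n w → Pre i v w → ∃₂ λ u z → w ≡ u ++ z × insert-zero i w ≡ ins u z × AllPairs _<_ u × Safe u z ×
      (Pre i (suc v) (ins u z) × ¬ Pre (suc i) (suc v) (ins u z))
    bwd {w} a p = take i w , drop i w , sym w≡ ,
      trans (cong₂ insert-zero (sym |u|) (sym w≡)) (insert-zero-ins (take i w) (drop i w)) ,
      prefix-increasing i 1≤v 1≤i a p , short-Safe (take i w) (drop i w) (subst (_< α) (sym |u|) i<α) ,
      Pre-ins⁺ i (take i w) (Pre-++ i (take i w) (ℕₚ.≤-reflexive (sym |u|)) (subst (Pre i v) (sym w≡) p)) , not-longer
      where
      w≡ : take i w ++ drop i w ≡ w
      w≡ = Listₚ.take++drop≡id i w
      |u| : length (take i w) ≡ i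
      |u| = trans (Listₚ.length-take i w) (ℕₚ.m≤n⇒m⊓n≡m (Pre-≤ i p))
      not-longer : ¬ Pre (suc i) (suc v) (ins (take i w) (drop i w))
      not-longer p′ = ℕₚ.<⇒≱ (ℕₚ.n<1+n i) (ℕₚ.≤-trans (Pre-≤ (suc i) {v} (subst (Pre (suc i) v) (Listₚ.++-identityʳ (take i w))
        (Pre-ins⁻ (suc i) (take i w) [] p′))) (ℕₚ.≤-reflexive |u|))

  -- If the second entry does not exceed the head, it is 0, and deleting it lowers the head to v.
  #-second-zero : ∀ v n → suc v ≤ β →
    # (headPre? 0 (suc v)) (suc n) ≡ # (headPre? 1 (suc v)) (suc n) + # (headPre? 0 v) n
  #-second-zero v n v<β = trans
    (#-difference (headPre? 0 (suc v)) (headPre? 1 (suc v)) (suc n) (λ {w} → shorten w))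
    (cong (_+_ (# (headPre? 1 (suc v)) (suc n)))
      (zero-bijection (λ w → headPre? 0 (suc v) w ×-dec ¬? (headPre? 1 (suc v) w)) (headPre? 0 v) (insert-zero 1) n fwd bwd))
    where
    shorten : ∀ w → HeadPre 1 (suc v) w → HeadPre 0 (suc v) w
    shorten (x ∷ w) (x≡ , _) = x≡ , tt
    fwd : ∀ u z → Av α β (suc n) (ins u z) → HeadPre 0 (suc v) (ins u z) × ¬ HeadPre 1 (suc v) (ins u z) →
      HeadPre 0 v (u ++ z) × insert-zero 1 (u ++ z) ≡ ins u z
    fwd []          z a ((() , _) , _)
    fwd (x ∷ [])    z a ((refl , _) , _) = (refl , tt) , refl
    fwd (x ∷ y ∷ u) z a ((refl , _) , ¬p) with (x<y ∷ _) ∷ _ ← ins-increasing (x ∷ y ∷ u) z a =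
      contradiction (refl , s≤s x<y , tt) ¬p
    bwd : ∀ {w} → Av α β n w → HeadPre 0 v w → ∃₂ λ u z → w ≡ u ++ z × insert-zero 1 w ≡ ins u z × AllPairs _<_ u × Safe u z ×
      (HeadPre 0 (suc v) (ins u z) × ¬ HeadPre 1 (suc v) (ins u z))
    bwd {x ∷ z} a (refl , _) = x ∷ [] , z , refl , refl , [] ∷ [] , singleton-Safe x z a v<β , (refl , tt) , λ { (_ , () , _) }

  #-first-zero : ∀ n → # (headPre? 0 0) (suc n) ≡ # (pre? 0 0) n
  #-first-zero n = zero-bijection (headPre? 0 0) (pre? 0 0) (insert-zero 0) n fwd
    (λ {w} a _ → [] , w , refl , refl , [] , short-Safe [] w 1≤α , (refl , tt))
    where
    fwd : ∀ u z → Av α β (suc n) (ins u z) → HeadPre 0 0 (ins u z) → Pre 0 0 (u ++ z) × insert-zero 0 (u ++ z) ≡ ins u z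
    fwd []      z a _        = tt , refl
    fwd (x ∷ u) z a (() , _)

  -- When the first α entries exceed β, an entry ≠ 1 right after the 0 would complete an occurrence whose last β entries are 1,…,β.
  after-zero : ∀ {n} u z → Av α β (suc n) (ins u z) → Pre α (suc β) (ins u z) → ∃[ z′ ] z ≡ 0 ∷ z′
  after-zero {n} u z a p = head-zero z refl
    where
    p-u : Pre α β u
    p-u = subst (Pre α β) (Listₚ.++-identityʳ u) (Pre-ins⁻ α u [] p)
    head≥ : ∀ i u → 1 ≤ i → Pre i β u → ∃₂ λ x u′ → u ≡ x ∷ u′ × β ≤ x
    head≥ (suc i) (x ∷ u) _ (β≤x , _) = x , u , refl , β≤x
    u≥β : ∀ {x} → x ∈ map suc u → suc β ≤ x
    u≥β x∈ with x′ , x′∈ , refl ← ∈-map⁻ suc x∈ with _ , _ , refl , β≤x ← head≥ α u 1≤α p-u =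
      s≤s (All.lookup (increasing-All (ins-increasing u z a) β≤x) x′∈)
    β<n : β < n
    β<n with x , u′ , refl , β≤x ← head≥ α u 1≤α p-u = ℕₚ.≤-<-trans β≤x (ℕₚ.≤-pred (All.head (bound a)))
    small∈z : ∀ {j} → j < β → suc j ∈ map suc z
    small∈z {j} j<β with ∈-++⁻ (map suc u) (full a (s≤s (ℕₚ.<-trans j<β β<n)))
    ... | inj₁ j∈         = contradiction (ℕₚ.≤-pred (u≥β j∈)) (ℕₚ.<⇒≱ j<β)
    ... | inj₂ (there j∈) = j∈
    head-zero : ∀ z′ → z ≡ z′ → ∃[ z″ ] z′ ≡ 0 ∷ z″
    head-zero []           refl with () ← small∈z 1≤β
    head-zero (zero ∷ z′)  refl = z′ , refl
    head-zero (suc y ∷ z′) refl with suc y <? β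
    -- Here the entry after the 0 is between 2 and β: with the larger first entry and the 1 still to
    -- come it forms a 321.
    ... | yes y<β with x , u′ , refl , β≤x ← head≥ α u 1≤α p-u with small∈z 1≤β
    ...   | there 1∈ = contradiction (s≤s (s≤s z≤n))
      (no321 a (refl {x = suc x} ∷ ++-⊆ˡ (map suc u′) (0 ∷ʳ refl {x = suc (suc y)} ∷ from∈ 1∈)) (s≤s (ℕₚ.<-≤-trans y<β β≤x)))
    -- Here that entry exceeds β and serves as t; the values 1,...,β cannot precede the 0, so they
    -- all come after t.
    head-zero (suc y ∷ z′) refl | no y≮β = contradiction
      (occ (++-⊆ (take-⊆ α (map suc u)) (refl ∷ refl ∷ ⊆-trans (take-⊆ β small) (filter-⊆ (_<? suc β) (map suc z′))))
        (|take| α (map suc u) (ℕₚ.≤-trans (Pre-≤ α p-u) (ℕₚ.≤-reflexive (sym (Listₚ.length-map suc u)))))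
        (|take| β small (subst (_≤ length small) (trans (Listₚ.length-map suc (upTo β)) (Listₚ.length-upTo β)) enough))
        cross)
      (noOcc a)
      where
      |take| : ∀ m (xs : List ℕ) → m ≤ length xs → length (take m xs) ≡ m
      |take| m xs m≤ = trans (Listₚ.length-take m xs) (ℕₚ.m≤n⇒m⊓n≡m m≤)
      small = filter (_<? suc β) (map suc z′)
      enough : length (map suc (upTo β)) ≤ length small
      enough = length-⊆ (Uniqueₚ.map⁺ ℕₚ.suc-injective (Uniqueₚ.upTo⁺ β)) λ x∈ → in-small (∈-map⁻ suc x∈)
        where
        in-small : ∀ {x} → (∃[ j ] j ∈ upTo β × x ≡ suc j) → x ∈ small
        in-small (j , j∈ , refl) with j<β ← ∈-upTo⁻ j∈ with small∈z j<β
        ... | here refl = contradiction j<β y≮β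
        ... | there q   = ∈-filter⁺ (_<? suc β) q (s≤s j<β)
      cross : Cross (take α (map suc u)) 0 (suc (suc y)) (take β small)
      cross x∈ e∈ = ℕₚ.<-≤-trans (low e∈) (high x∈)
        where
        low : ∀ {e} → e ∈ 0 ∷ take β small → e < suc β
        low (here refl) = s≤s z≤n
        low (there e∈)  = proj₂ (∈-filter⁻ (_<? suc β) {xs = map suc z′} (lookup (take-⊆ β small) e∈))
        high : ∀ {x} → x ∈ suc (suc y) ∷ take α (map suc u) → suc β ≤ x
        high (here refl) = s≤s (ℕₚ.≮⇒≥ y≮β)
        high (there x∈)  = u≥β (lookup (take-⊆ α (map suc u)) x∈)

  -- By `after-zero` the old 0 marks the place for the new one. Now α entries precede it, so
  -- shortness no longer protects; safety rests on the adjacent 1.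
  #-double-zero : ∀ n → # (pre? α (suc β)) (suc n) ≡ # (pre? α β) n
  #-double-zero n = zero-bijection (pre? α (suc β)) (pre? α β) double-zero n fwd bwd
    where
    fwd : ∀ u z → Av α β (suc n) (ins u z) → Pre α (suc β) (ins u z) → Pre α β (u ++ z) × double-zero (u ++ z) ≡ ins u z
    fwd u z a p with z′ , refl ← after-zero u z a p = Pre-ins⁻ α u z p , double-zero-ins u z′ 0∉u
      where
      0∉u : 0 ∉ u
      0∉u 0∈ = Unique⇒≢ (uniq (del-Av u z a)) (++-⊆ (from∈ 0∈) (refl {x = 0} ∷ minimum _)) refl
    bwd : ∀ {w} → Av α β n w → Pre α β w → ∃₂ λ u z → w ≡ u ++ z × double-zero w ≡ ins u z × AllPairs _<_ u × Safe u z × Pre α (suc β) (ins u z)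
    bwd {[]} a p with Pre-≤ α p
    ... | α≤0 = contradiction 1≤α (ℕₚ.<⇒≱ (s≤s α≤0))
    bwd {w@(_ ∷ _)} a p with u , z , w≡ ← ∈-∃++ (full a (subst (1 ≤_) (len a) (s≤s z≤n))) =
      u , 0 ∷ z , w≡ , trans (cong double-zero w≡) (double-zero-ins u z 0∉u) , increasing , safe ,
      Pre-ins⁺ α u (Pre-zero α u 1≤β (subst (Pre α β) w≡ p))
      where
      a′ : Av α β n (u ++ 0 ∷ z)
      a′ = subst (Av α β n) w≡ a
      0∉u : 0 ∉ u
      0∉u 0∈ = Unique⇒≢ (uniq a′) (++-⊆ (from∈ 0∈) (refl {x = 0} ∷ minimum _)) refl
      increasing : AllPairs _<_ u
      increasing = AllPairs-⊆ u λ {x} {y} σ → ≮∧≢⇒<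
        (λ y<x → no321 a′ (++-⊆ σ (refl {x = 0} ∷ minimum _)) y<x
          (ℕₚ.n≢0⇒n>0 λ y≡0 → 0∉u (subst (_∈ u) y≡0 (lookup σ (there (here refl))))))
        (Unique⇒≢ (uniq a′) (⊆-trans σ (++-⊆ʳ (0 ∷ z) ⊆-refl)))
      -- The entry 1 just after the inserted 0 could replace it in any occurrence.
      safe : Safe u (0 ∷ z)
      safe Ts t []       _ _ _ |Bs| _ = contradiction (subst (1 ≤_) (sym |Bs|) 1≤β) λ ()
      safe Ts t (B ∷ Bs) q r |Ts| |Bs| cross with ∈-map⁻ suc {xs = 0 ∷ z} (lookup r (there (here refl)))
      -- The entry 1 cannot be `t`, which must exceed the positive letter `B`.
      safe Ts t (B ∷ Bs) q (refl ∷ r)    |Ts| |Bs| cross | _ , _ , refl with s≤s () ← cross (here refl) (there (here refl))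
      safe Ts t (B ∷ Bs) q (.1 ∷ʳ r) |Ts| |Bs| cross | _ , _ , refl =
        noOcc a′ (Occ-map-suc⁻ (u ++ 0 ∷ z) (subst (Occ α β) (sym (Listₚ.map-++ suc u (0 ∷ z)))
          (occ (++-⊆ q (refl ∷ r)) |Ts| |Bs| cross′)))
        where
        cross′ : Cross Ts 1 t (B ∷ Bs)
        cross′ x∈ (here refl) = ℕₚ.<-≤-trans (s≤s (s≤s z≤n)) (cross x∈ (there (here refl)))
        cross′ x∈ (there e∈)  = cross x∈ (there e∈)

  -- The chain of counts and its recursion

  total : ℕ → ℕ
  total n = countᵇ (avᵇ n) (words n n)

  #-total : ∀ n → # (pre? 0 0) n ≡ total n
  #-total n = countᵇ-cong (words n n) λ w → ∧-identityʳ (avᵇ n w)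

  total-zero : total 0 ≡ 1
  total-zero with avᵇ 0 [] | proj₂ (Av⇒avᵇ (av refl [] [] (λ ()) ¬Occ-[]))
    where
    ¬Occ-[] : ¬ Occ α β []
    ¬Occ-[] (occ {[]}    () _ _ _)
    ¬Occ-[] (occ {_ ∷ _} () _ _ _)
  ... | true | _ = refl

  #-pre-zero : ∀ i v → # (pre? (suc i) v) 0 ≡ 0
  #-pre-zero i v rewrite ∧-zeroʳ (avᵇ 0 []) = refl

  #-pre-one : ∀ n → # (pre? 1 0) (suc n) ≡ total (suc n)
  #-pre-one n = trans (#-cong (pre? 1 0) (pre? 0 0) (suc n) (λ _ _ → tt) (λ {w} → nonempty w)) (#-total (suc n))
    where
    nonempty : ∀ w → Av α β (suc n) w → Pre 0 0 w → Pre 1 0 w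
    nonempty []      a _ with () ← len a
    nonempty (x ∷ w) _ _ = z≤n , tt

  -- No direct bijection is needed: removing a head β on one side and a 0 on the other leaves the
  -- same class of size one less, and what remains of the two sides coincides.
  #-shift : ∀ i n → 1 ≤ i → i < α → # (pre? (suc i) β) n ≡ # (pre? i (suc β)) n
  #-shift (suc i) zero    _   _   = trans (#-pre-zero (suc i) β) (sym (#-pre-zero i (suc β)))
  #-shift i       (suc n) 1≤i i<α = begin
    # (pre? (suc i) β) (suc n)                                          ≡⟨ #-head-min i β (suc n) (inj₂ 1≤β) ⟩
    # (pre? (suc i) (suc β)) (suc n) + # (headPre? i β) (suc n)         ≡⟨ cong (_+_ (# (pre? (suc i) (suc β)) (suc n))) (#-remove-head i β n 1≤i ℕₚ.≤-refl) ⟩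
    # (pre? (suc i) (suc β)) (suc n) + # (pre? i β) n                   ≡⟨ #-zero-at i β n 1≤β 1≤i i<α ⟨
    # (pre? i (suc β)) (suc n)                                          ∎

  -- The cases "second entry larger" and "second entry 0" shrink to "first entry above v" and "first
  -- entry v", which together make up the class on the right.
  #-head : ∀ v n → suc v ≤ β → # (headPre? 0 (suc v)) (suc n) ≡ # (pre? 1 v) n
  #-head v n v<β = begin
    # (headPre? 0 (suc v)) (suc n)                                ≡⟨ #-second-zero v n v<β ⟩
    # (headPre? 1 (suc v)) (suc n) + # (headPre? 0 v) n           ≡⟨ cong (_+ # (headPre? 0 v) n) (#-remove-head 1 (suc v) n ℕₚ.≤-refl v<β) ⟩
    # (pre? 1 (suc v)) n + # (headPre? 0 v) n                     ≡⟨ #-head-min 0 v n (inj₁ refl) ⟨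
    # (pre? 1 v) n                                                ∎

  -- Q (suc s) counts by the first entry being ≥ s as long as s ≤ d = suc β, and
  -- then by the first 1 + (s ∸ d) entries being ≥ d.
  Q : ℕ → ℕ → ℕ
  Q zero    = total
  Q (suc s) = # (pre? (suc (s ∸ suc β)) (s ⊓ suc β))

  Q-low : ∀ s n → s ≤ suc β → Q (suc s) n ≡ # (pre? 1 s) n
  Q-low s n s≤ = cong₂ (λ i v → # (pre? (suc i) v) n) (ℕₚ.m≤n⇒m∸n≡0 s≤) (ℕₚ.m≤n⇒m⊓n≡m s≤)

  Q-high : ∀ j n → Q (suc (suc β + j)) n ≡ # (pre? (suc j) (suc β)) n
  Q-high j n = cong₂ (λ i v → # (pre? (suc i) v) n) (ℕₚ.m+n∸m≡n (suc β) j) (ℕₚ.m≥n⇒m⊓n≡n (ℕₚ.m≤m+n (suc β) j))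

  -- A second description of `Q`, with threshold β = d-1: the form in which the smaller class
  -- appears after deletion of 0.
  Q-restricted : ∀ i n → i < α → Q (suc (β + i)) n ≡ # (pre? (suc i) β) n
  Q-restricted zero    n _   = trans (cong (λ s → Q (suc s) n) (ℕₚ.+-identityʳ β)) (Q-low β n (ℕₚ.n≤1+n β))
  Q-restricted (suc i) n i<α = trans (cong (λ s → Q (suc s) n) (ℕₚ.+-suc β i))
    (trans (Q-high i n) (sym (#-shift (suc i) n (s≤s z≤n) i<α)))

  Q-step : ∀ s n → s < α + β → Q (suc s) (suc n) ≡ Q (suc (suc s)) (suc n) + Q s n
  Q-step zero n _ = begin
    Q 1 (suc n)                                           ≡⟨ Q-low 0 (suc n) z≤n ⟩
    # (pre? 1 0) (suc n)                                  ≡⟨ #-head-min 0 0 (suc n) (inj₁ refl) ⟩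
    # (pre? 1 1) (suc n) + # (headPre? 0 0) (suc n)       ≡⟨ cong₂ _+_ (sym (Q-low 1 (suc n) (s≤s z≤n))) (trans (#-first-zero n) (#-total n)) ⟩
    Q 2 (suc n) + Q 0 n                                   ∎
  Q-step (suc s) n s< with suc s ≤? β
  ... | yes s<β = begin
    Q (suc (suc s)) (suc n)                                       ≡⟨ Q-low (suc s) (suc n) (ℕₚ.m≤n⇒m≤1+n s<β) ⟩
    # (pre? 1 (suc s)) (suc n)                                    ≡⟨ #-head-min 0 (suc s) (suc n) (inj₁ refl) ⟩
    # (pre? 1 (suc (suc s))) (suc n) + # (headPre? 0 (suc s)) (suc n)
      ≡⟨ cong₂ _+_ (sym (Q-low (suc (suc s)) (suc n) (s≤s s<β))) (trans (#-head s n s<β) (sym (Q-low s n (ℕₚ.m≤n⇒m≤1+n (ℕₚ.<⇒≤ s<β))))) ⟩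
    Q (suc (suc (suc s))) (suc n) + Q (suc s) n                   ∎
  -- From here the condition concerns the first `suc j` entries, with s = β + j, and the class split
  -- off has its 0 right after them.
  ... | no s≮β = subst (λ s → Q (suc (suc s)) (suc n) ≡ Q (suc (suc (suc s))) (suc n) + Q (suc s) n) β+j≡s (begin
    Q (suc (suc β + j)) (suc n)                                       ≡⟨ Q-high j (suc n) ⟩
    # (pre? (suc j) (suc β)) (suc n)                                  ≡⟨ #-zero-at (suc j) β n 1≤β (s≤s z≤n) j<α ⟩
    # (pre? (suc (suc j)) (suc β)) (suc n) + # (pre? (suc j) β) n
      ≡⟨ cong₂ _+_ (trans (sym (Q-high (suc j) (suc n))) (cong (λ l → Q (suc (suc l)) (suc n)) (ℕₚ.+-suc β j)))
                   (sym (Q-restricted j n (ℕₚ.<-trans (ℕₚ.n<1+n j) j<α))) ⟩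
    Q (suc (suc (suc (β + j)))) (suc n) + Q (suc (β + j)) n           ∎)
    where
    j = s ∸ β
    β+j≡s : β + j ≡ s
    β+j≡s = ℕₚ.m+[n∸m]≡n (ℕₚ.≤-pred (ℕₚ.≰⇒> s≮β))
    j<α : suc j < α
    j<α = ℕₚ.+-cancelˡ-< β (suc j) α (subst₂ _<_ (trans (cong suc (sym β+j≡s)) (sym (ℕₚ.+-suc β j))) (ℕₚ.+-comm α β) s<)

  Q-top : ∀ n → Q (suc (α + β)) (suc n) ≡ Q (α + β) n
  Q-top n = go α refl
    where
    go : ∀ α′ → α ≡ α′ → Q (suc (α + β)) (suc n) ≡ Q (α + β) n
    go zero    α≡0 = contradiction (subst (1 ≤_) α≡0 1≤α) λ ()
    go (suc i) α≡ = begin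
      Q (suc (α + β)) (suc n)             ≡⟨ cong (λ l → Q (suc l) (suc n)) α+β≡ ⟩
      Q (suc (suc β + i)) (suc n)         ≡⟨ Q-high i (suc n) ⟩
      # (pre? (suc i) (suc β)) (suc n)    ≡⟨ cong (λ l → # (pre? l (suc β)) (suc n)) α≡ ⟨
      # (pre? α (suc β)) (suc n)          ≡⟨ #-double-zero n ⟩
      # (pre? α β) n                      ≡⟨ cong (λ l → # (pre? l β) n) α≡ ⟩
      # (pre? (suc i) β) n                ≡⟨ Q-restricted i n (ℕₚ.≤-reflexive (sym α≡)) ⟨
      Q (suc β + i) n                     ≡⟨ cong (λ l → Q l n) α+β≡ ⟨
      Q (α + β) n                         ∎
      where
      α+β≡ : α + β ≡ suc β + i
      α+β≡ = trans (cong (_+ β) α≡) (cong suc (ℕₚ.+-comm i β))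

  open Chain (α + β) Q total-zero (λ s → #-pre-zero (s ∸ suc β) (s ⊓ suc β)) (λ n → trans (Q-low 0 (suc n) z≤n) (#-pre-one n)) Q-step Q-top public

-- The pattern of the theorem

module Concrete (α β : ℕ) (1≤α : 1 ≤ α) (1≤β : 1 ≤ β) where

  k d : ℕ
  k = suc (suc (α + β))
  d = suc β

  T₀ B₀ : List ℕ
  T₀ = map (λ i → suc d + i) (upTo α)
  B₀ = map (λ i → 2 + i) (upTo β)

  pattern≡ : T₀ ++ 1 ∷ k ∷ B₀ ≡ patternKD k d
  pattern≡ = cong (λ l → map (λ i → suc d + i) (upTo l) ++ 1 ∷ k ∷ B₀) (sym (ℕₚ.m+n∸n≡m α β))

  |T₀| : length T₀ ≡ α
  |T₀| = trans (Listₚ.length-map _ (upTo α)) (Listₚ.length-upTo α)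

  |B₀| : length B₀ ≡ β
  |B₀| = trans (Listₚ.length-map _ (upTo β)) (Listₚ.length-upTo β)

  T₀<k : ∀ {i} → i < α → suc d + i < k
  T₀<k {i} i<α = s≤s (s≤s (subst (_< α + β) (ℕₚ.+-comm i β) (ℕₚ.+-monoˡ-< β i<α)))

  -- The value d separates the letters: 1,...,d on one side and d+1,...,k on the other.
  cross₀ : Cross T₀ 1 k B₀
  cross₀ x∈ e∈ = ℕₚ.<-≤-trans (low e∈) (high x∈)
    where
    low : ∀ {e} → e ∈ 1 ∷ B₀ → e < suc d
    low (here refl) = s≤s (s≤s z≤n)
    low (there e∈) with i , i∈ , refl ← ∈-map⁻ (λ i → 2 + i) e∈ = s≤s (s≤s (∈-upTo⁻ i∈))
    high : ∀ {x} → x ∈ k ∷ T₀ → suc d ≤ x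
    high (here refl) = s≤s (s≤s (ℕₚ.m≤n+m β α))
    high (there x∈) with i , _ , refl ← ∈-map⁻ (λ i → suc d + i) x∈ = ℕₚ.m≤m+n (suc d) i

  increasing-T₀ : AllPairs _<_ (T₀ ++ k ∷ [])
  increasing-T₀ = AllPairsₚ.++⁺
    (AllPairsₚ.map⁺ (AllPairsₚ.applyUpTo⁺₁ _ α (λ i<j _ → ℕₚ.+-monoʳ-< (suc d) i<j)))
    ([] ∷ [])
    (Allₚ.map⁺ (All.tabulate λ i∈ → T₀<k (∈-upTo⁻ i∈) ∷ []))

  increasing-B₀ : AllPairs _<_ (1 ∷ B₀)
  increasing-B₀ = Allₚ.map⁺ (All.tabulate λ _ → s≤s (s≤s z≤n)) ∷
    AllPairsₚ.map⁺ (AllPairsₚ.applyUpTo⁺₁ _ β (λ i<j _ → s≤s (s≤s i<j)))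

  open Pattern T₀ 1 k B₀ cross₀ using (Contains⇒Occ; Occ⇒Contains)

  open Counting α β 1≤α 1≤β (patternKD k d)
    (λ {w} c → subst₂ (λ a b → Occ a b w) |T₀| |B₀| (Contains⇒Occ (subst (Contains w) (sym pattern≡) c)))
    (λ {w} no321 w! o → subst (Contains w) pattern≡
      (Occ⇒Contains increasing-T₀ increasing-B₀ (subst (1 ≤_) (sym |T₀|) 1≤α) (subst (1 ≤_) (sym |B₀|) 1≤β) no321 w!
        (subst₂ (λ a b → Occ a b w) (sym |T₀|) (sym |B₀|) o))) public

<⇒∃+ : ∀ {m n} → m < n → ∃[ l ] 1 ≤ l × l + m ≡ n
<⇒∃+ {m} {n} m<n = n ∸ m , ℕₚ.m<n⇒0<n∸m m<n , ℕₚ.m∸n+n≡m (ℕₚ.<⇒≤ m<n)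

theorem3p3 : (k d : ℕ) → 4 ≤ k → 2 ≤ d → d ≤ k ∸ 2 →
    ((n : ℕ) → k ≤ n →
    sumTo k (λ j → sign j ℤ.* ((+ ((k ∸ j) C j)) ℤ.* (+ x3 k d (n ∸ j)))) ≡ + 0)
    × ((n : ℕ) → n < k → x3 k d n ≡ ((2 * n) C n) / suc n)
    × ((n : ℕ) → ((λ i → + x3 k d i) ⊛ Ũ k) n ≡ Ũ (k ∸ 1) n)
theorem3p3 (suc (suc K)) (suc β) (s≤s (s≤s _)) (s≤s 1≤β) β<K
  -- α = k-1-d counts the leading letters d+1,...,k-1, and d ≤ k-2 makes it positive.
  with α , 1≤α , refl ← <⇒∃+ β<K =
  recurrence , initial-values , generating-function
  where open Concrete α β 1≤α 1≤β
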